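{- Let $m,n,s,k$ be positive integers with $s$ and $k$ even. There exists an integer ${}^{2}\mathrm{H}(m,n;s,k)$ if and only if $ms=nk$, $2\le s\le n$, $2\le k\le m$, and moreover: (1) if $s=2$, then either $n=2$ and $m=k\equiv 0\pmod 4$, or $n,k\ge 3$; (2) if $k=2$, then either $m=2$ and $n=s\equiv 0\pmod 4$, or $m,s\ge 3$.
   Context: A partially filled (p.f.) array is a matrix in which some cells may be empty. With $ms=nk$, ${}^{2}\mathrm{H}(m,n;s,k)$ denotes an $m\times n$ p.f. array with entries in $\mathbb{Z}_{nk+1}$ such that: (a) each row has exactly $s$ filled cells and each column exactly $k$ filled cells; (b) the multiset $\{\pm x : x \text{ an entry of a filled cell}\}$ (with multiplicity) contains each nonzero element of $\mathbb{Z}_{nk+1}$ exactly $2$ times; (c) every row and column sums to $0$ in $\mathbb{Z}_{nk+1}$. It is integer if, when each entry is viewed as an integer in $\pm\{1,2,\dots,\lfloor (nk+1)/2\rfloor\}$, every row and every column sums to $0$ in $\mathbb{Z}$. -}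

module Defs where

open import Data.Nat using (ℕ; zero; suc; _+_; _*_; _∸_; _≤ᵇ_; _≟_)
open import Data.Nat.DivMod using (_/_; _%_)
open import Data.Integer as ℤ using (ℤ; +_; -_)
open import Data.Fin using (Fin; toℕ)
open import Data.List using (List; []; _∷_; map; mapMaybe; concatMap; allFin; length; filter)
open import Data.Nat.ListAction using (sum)
open import Data.Maybe using (Maybe; just; nothing)
open import Data.Bool using (if_then_else_)
open import Data.Product using (_×_)
open import Relation.Binary.PropositionalEquality using (_≡_)

-- A partially filled m × n array with entries in ℤ_N, where ℤ_N is
-- represented by Fin N (residues 0,…,N-1); 'nothing' = empty cell.
PFArray : ℕ → ℕ → ℕ → Set
PFArray m n N = Fin m → Fin n → Maybe (Fin N)

rowEntries : ∀ {m n N} → PFArray m n N → Fin m → List (Fin N)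
rowEntries {n = n} A i = mapMaybe (A i) (allFin n)

colEntries : ∀ {m n N} → PFArray m n N → Fin n → List (Fin N)
colEntries {m = m} A j = mapMaybe (λ i → A i j) (allFin m)

allEntries : ∀ {m n N} → PFArray m n N → List (Fin N)
allEntries {m = m} A = concatMap (rowEntries A) (allFin m)

pmList : (N : ℕ) → List (Fin (suc N)) → List ℕ
pmList N = concatMap (λ x → toℕ x ∷ ((suc N ∸ toℕ x) % suc N) ∷ [])

mult : ℕ → List ℕ → ℕ
mult r l = length (filter (_≟ r) l)

sumMod : (N : ℕ) → List (Fin (suc N)) → ℕ
sumMod N l = sum (map toℕ l) % suc N

IsH2 : (m n s k : ℕ) → PFArray m n (suc (n * k)) → Set
IsH2 m n s k A =
  ((i : Fin m) → length (rowEntries A i) ≡ s) ×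
  ((j : Fin n) → length (colEntries A j) ≡ k) ×
  ((r : ℕ) → 1 Data.Nat.≤ r → r Data.Nat.< suc (n * k) →
     mult r (pmList (n * k) (allEntries A)) ≡ 2) ×
  ((i : Fin m) → sumMod (n * k) (rowEntries A i) ≡ 0) ×
  ((j : Fin n) → sumMod (n * k) (colEntries A j) ≡ 0)

-- view a residue x ∈ ℤ_N as the integer in {-(N-1-⌊N/2⌋),…,⌊N/2⌋}
-- (for N odd this is ±{0,1,…,⌊N/2⌋})
lift : (N : ℕ) → Fin (suc N) → ℤ
lift N x = if toℕ x ≤ᵇ (suc N / 2) then + toℕ x else - (+ (suc N ∸ toℕ x))

sumℤ : List ℤ → ℤ
sumℤ = Data.List.foldr ℤ._+_ (+ 0)

IsInteger : (m n N : ℕ) → PFArray m n (suc N) → Set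
IsInteger m n N A =
  ((i : Fin m) → sumℤ (map (lift N) (rowEntries A i)) ≡ + 0) ×
  ((j : Fin n) → sumℤ (map (lift N) (colEntries A j)) ≡ + 0)

{-# OPTIONS --safe #-}
module Submission where

-- Sufficiency. Write s = 2S, k = 2K. Number the cells c = 0, …, nk ∸ 1, put cell c into row ⌊c/s⌋ and
-- column c mod n, and give the cells 2q and 2q + 1 opposite entries ±x_q with {∣x_q∣} = {1, …, nK}.
-- The rows then sum to zero, and only the column sums have to be arranged. For n even the x_q form a
-- 2K × n/2 matrix that must have zero column sums; for n odd they form a K × n matrix that must have equal
-- column sums. Four consecutive labels +, −, −, + (respectively two labels +, −) reduce K by 2, so only
-- K = 3 needs work (K = 1 is handled by transposing): a Kotzig-like array for n odd, a tiling by 6 × 2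
-- blocks for 4 ∣ n, and one extra 6 × 3 block with columns permuted in two layers for n ≡ 2 (mod 4).
-- Necessity. For s = k = 2 the cells ±1 contradict the multiplicity, and for n = s = 2 the first column
-- contains ±1, …, ±k with sum zero, so that k (k + 1) / 2 is even.

open import Defs
open import Algebra.Bundles using (CommutativeMonoid)
import Algebra.Properties.CommutativeMonoid.Sum as CMSum
import Algebra.Solver.CommutativeMonoid as MonoidSolver
open import Data.Bool using (true; false; if_then_else_)
open import Data.Empty using (⊥; ⊥-elim)
open import Data.Fin as Fin using (Fin; toℕ; #_)
open import Data.Fin.Properties using (toℕ<n; toℕ-fromℕ<)
open import Data.Integer as ℤ using (ℤ; +_; -_; -[1+_]; ∣_∣)
import Data.Integer.Properties as ℤ
import Data.Integer.Tactic.RingSolver as ℤSolver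
open import Data.List using (List; []; _∷_; _++_; foldr; map; mapMaybe; concatMap; allFin; length; tabulate)
open import Data.List.Properties using (length-mapMaybe; length-tabulate)
open import Data.List.Relation.Unary.All using (All; []; _∷_)
open import Data.Maybe using (Maybe; just; nothing; maybe′)
open import Data.Nat using (ℕ; zero; suc; _+_; _*_; _∸_; _≤_; _<_; z≤n; s≤s; z<s; s<s; _≡ᵇ_; _≤ᵇ_; _≤?_; NonZero; >-nonZero)
open import Data.Nat.DivMod using (_/_; _%_; _mod_; m<n⇒m%n≡m; m<n⇒m/n≡0; m%n<n; n%n≡0; m*n%n≡0; [m+n]%n≡m%n; [m+kn]%n≡m%n; +-distrib-/-∣ʳ; m*n/n≡m; m≡m%n+[m/n]*n; /-monoˡ-≤)
open import Data.Nat.Divisibility using (_∣_; divides)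
import Data.Nat.ListAction as ℕList
import Data.Nat.Properties as ℕ
import Data.Nat.Tactic.RingSolver as ℕSolver
open import Data.Product using (Σ; _×_; _,_; proj₁; proj₂; ∃)
open import Data.Sum using (_⊎_; inj₁; inj₂)
import Data.Vec as Vec
open import Data.Vec.Functional using (removeAt)
open import Function using (_∘_; id)
open import Function.Bundles using (_⇔_; mk⇔)
open import Level using (0ℓ)
open import Relation.Binary.PropositionalEquality using (_≡_; _≢_; refl; sym; trans; cong; cong₂; subst; module ≡-Reasoning)
import Relation.Binary.Reasoning.Setoid as SetoidReasoning
open import Relation.Nullary using (Dec; yes; no; ¬_; does)
open import Relation.Nullary.Decidable using (_×-dec_; dec-true; dec-false)


-- A row consists of s consecutive cells starting at an even index, hence of whole opposite pairs,
-- and its sum vanishes whatever the labels are. How the pairs meet the columns depends on the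
-- parity of n. For even n a layer of n cells holds n/2 whole pairs, and columns 2i and 2i + 1 carry
-- column i of the labels with opposite signs. For odd n every second layer boundary cuts a pair:
-- over two layers, a column of the array meets one column of labels with sign + and another with
-- sign -, so that a common column sum cancels. For even n and K = 3 the obstacle is parity: six
-- consecutive labels contain three odd ones and cannot be signed to zero, so columns are completed
-- in pairs, and this brings in n modulo 4. Lengths, multiplicities and sums are all treated as
-- weighted sums over the filled cells, with values in the commutative monoid ℕ or ℤ. Permutations
-- of labels thus enter only as identities between sums.

≡ᵇ-refl : ∀ a → (a ≡ᵇ a) ≡ true
≡ᵇ-refl zero    = refl
≡ᵇ-refl (suc a) = ≡ᵇ-refl a

≢⇒≡ᵇ-false : ∀ {a b} → a ≢ b → (a ≡ᵇ b) ≡ false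
≢⇒≡ᵇ-false {zero}  {zero}  a≢b = ⊥-elim (a≢b refl)
≢⇒≡ᵇ-false {zero}  {suc b} a≢b = refl
≢⇒≡ᵇ-false {suc a} {zero}  a≢b = refl
≢⇒≡ᵇ-false {suc a} {suc b} a≢b = ≢⇒≡ᵇ-false (a≢b ∘ cong suc)

≡ᵇ-cong⇔ : ∀ {a b c d} → (a ≡ b → c ≡ d) → (c ≡ d → a ≡ b) → (a ≡ᵇ b) ≡ (c ≡ᵇ d)
≡ᵇ-cong⇔ {a} {b} {c} {d} f g with a ℕ.≟ b
... | yes a≡b = trans (cong (_≡ᵇ b) a≡b) (trans (≡ᵇ-refl b)
                  (sym (trans (cong (_≡ᵇ d) (f a≡b)) (≡ᵇ-refl d))))
... | no a≢b  = trans (≢⇒≡ᵇ-false a≢b) (sym (≢⇒≡ᵇ-false (a≢b ∘ g)))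

-- A row is a list of `s` cells, each with its column as key. The first match wins, so the row shows
-- all its cells only if the keys are distinct.
find : ∀ {B : Set} → ℕ → (ℕ → ℕ) → (ℕ → B) → ℕ → Maybe B
find zero    key val j = nothing
find (suc s) key val j = if key 0 ≡ᵇ j then just (val 0) else find s (key ∘ suc) (val ∘ suc) j

DistinctBelow : ℕ → (ℕ → ℕ) → Set
DistinctBelow s key = ∀ a b → a < b → b < s → key a ≢ key b

-- Finite sums in a commutative monoid, and arrays filled by lookup

module Sums (CM : CommutativeMonoid 0ℓ 0ℓ) where

  open CommutativeMonoid CM renaming (refl to ≈-refl; sym to ≈-sym; trans to ≈-trans)
  open CMSum CM using (sum; sum-cong-≋; ∑-distrib-+; ∑-comm; sum-replicate-zero)
  open SetoidReasoning setoid

  -- Recursive, rather than an instance of sum, so that f can be inferred from Σ< n f.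
  Σ< : ℕ → (ℕ → Carrier) → Carrier
  Σ< zero    f = ε
  Σ< (suc n) f = f 0 ∙ Σ< n (f ∘ suc)

  sum-toℕ : ∀ n f → sum {n} (λ i → f (toℕ i)) ≈ Σ< n f
  sum-toℕ zero    f = ≈-refl
  sum-toℕ (suc n) f = ∙-congˡ (sum-toℕ n (f ∘ suc))

  Σ-cong : ∀ n {f g} → (∀ i → i < n → f i ≈ g i) → Σ< n f ≈ Σ< n g
  Σ-cong zero    f≈g = ≈-refl
  Σ-cong (suc n) f≈g = ∙-cong (f≈g 0 z<s) (Σ-cong n λ i i<n → f≈g (suc i) (s<s i<n))

  Σ-∙ : ∀ n f g → Σ< n (λ i → f i ∙ g i) ≈ Σ< n f ∙ Σ< n g
  Σ-∙ n f g = ≈-trans (≈-sym (sum-toℕ n _))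
    (≈-trans (∑-distrib-+ {n} (f ∘ toℕ) (g ∘ toℕ)) (∙-cong (sum-toℕ n f) (sum-toℕ n g)))

  Σ-ε : ∀ n → Σ< n (λ _ → ε) ≈ ε
  Σ-ε n = ≈-trans (≈-sym (sum-toℕ n _)) (sum-replicate-zero n)

  Σ-swap : ∀ m n (f : ℕ → ℕ → Carrier) → Σ< m (λ i → Σ< n (λ j → f i j)) ≈ Σ< n (λ j → Σ< m (λ i → f i j))
  Σ-swap m n f = begin
    Σ< m (λ i → Σ< n (λ j → f i j))                         ≈⟨ sum-toℕ m _ ⟨
    sum {m} (λ i → Σ< n (λ j → f (toℕ i) j))                ≈⟨ sum-cong-≋ {m} (λ i → sum-toℕ n _) ⟨
    sum {m} (λ i → sum {n} (λ j → f (toℕ i) (toℕ j)))       ≈⟨ ∑-comm {m} {n} (λ i j → f (toℕ i) (toℕ j)) ⟩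
    sum {n} (λ j → sum {m} (λ i → f (toℕ i) (toℕ j)))       ≈⟨ sum-cong-≋ {n} (λ j → sum-toℕ m (λ i → f i (toℕ j))) ⟩
    sum {n} (λ j → Σ< m (λ i → f i (toℕ j)))                ≈⟨ sum-toℕ n (λ j → Σ< m (λ i → f i j)) ⟩
    Σ< n (λ j → Σ< m (λ i → f i j))                         ∎

  Σ-++ : ∀ a b f → Σ< (a + b) f ≈ Σ< a f ∙ Σ< b (λ j → f (a + j))
  Σ-++ zero    b f = ≈-sym (identityˡ _)
  Σ-++ (suc a) b f = ≈-trans (∙-congˡ (Σ-++ a b (f ∘ suc))) (≈-sym (assoc _ _ _))

  Σ-last : ∀ n f → Σ< (suc n) f ≈ Σ< n f ∙ f n
  Σ-last zero    f = comm _ _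
  Σ-last (suc n) f = ≈-trans (∙-congˡ (Σ-last n (f ∘ suc))) (≈-sym (assoc _ _ _))

  Σ-blocks : ∀ a b f → Σ< (a * b) f ≈ Σ< a (λ i → Σ< b (λ j → f (i * b + j)))
  Σ-blocks zero    b f = ≈-refl
  Σ-blocks (suc a) b f = begin
    Σ< (b + a * b) f                                             ≈⟨ Σ-++ b (a * b) f ⟩
    Σ< b f ∙ Σ< (a * b) (λ y → f (b + y))                        ≈⟨ ∙-congˡ (Σ-blocks a b _) ⟩
    Σ< b f ∙ Σ< a (λ i → Σ< b (λ j → f (b + (i * b + j))))       ≈⟨ ∙-congˡ (Σ-cong a λ i _ → Σ-cong b λ j _ →
                                                                      reflexive (cong f (sym (ℕ.+-assoc b (i * b) j)))) ⟩
    Σ< b f ∙ Σ< a (λ i → Σ< b (λ j → f (b + i * b + j)))         ∎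

  δ : ℕ → ℕ → Carrier → Carrier
  δ i j x = if i ≡ᵇ j then x else ε

  δ-≢ : ∀ {a b} x → a ≢ b → δ a b x ≈ ε
  δ-≢ x a≢b rewrite ≢⇒≡ᵇ-false a≢b = ≈-refl

  Σ-δ : ∀ n a (g : ℕ → Carrier) → a < n → Σ< n (λ j → δ j a (g j)) ≈ g a
  Σ-δ (suc n) zero    g _         = ≈-trans (∙-congˡ (Σ-ε n)) (identityʳ _)
  Σ-δ (suc n) (suc a) g (s<s a<n) = ≈-trans (identityˡ _) (Σ-δ n a (g ∘ suc) a<n)

  Σ-δ′ : ∀ n a (g : ℕ → Carrier) → a < n → Σ< n (λ j → δ a j (g j)) ≈ g a
  Σ-δ′ n a g a<n = ≈-trans
    (Σ-cong n λ j _ → reflexive (cong (λ b → if b then g j else ε) (≡ᵇ-cong⇔ {a} {j} {j} {a} sym sym)))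
    (Σ-δ n a g a<n)

  -- After the first match, distinctness of the keys makes every later δ vanish. In this form the
  -- order of summation over cells and columns can be exchanged.
  find-Σ : ∀ {B : Set} (w : B → Carrier) s key (val : ℕ → B) j → DistinctBelow s key →
           maybe′ w ε (find s key val j) ≈ Σ< s (λ a → δ (key a) j (w (val a)))
  find-Σ w zero    key val j dist = ≈-refl
  find-Σ w (suc s) key val j dist with key 0 ℕ.≟ j
  ... | yes refl rewrite ≡ᵇ-refl (key 0) = ≈-sym (≈-trans (∙-congˡ (≈-trans
          (Σ-cong s λ a a<s → δ-≢ _ (λ eq → dist 0 (suc a) z<s (s<s a<s) (sym eq))) (Σ-ε s)))
          (identityʳ _))
  ... | no key≢j rewrite ≢⇒≡ᵇ-false key≢j = ≈-trans
          (find-Σ w s (key ∘ suc) (val ∘ suc) j (λ a b a<b b<s → dist (suc a) (suc b) (s<s a<b) (s<s b<s)))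
          (≈-sym (identityˡ _))

  listSum : ∀ {B : Set} → (B → Carrier) → List B → Carrier
  listSum w = foldr (λ x acc → w x ∙ acc) ε

  listSum-++ : ∀ {B : Set} (w : B → Carrier) xs ys → listSum w (xs ++ ys) ≈ listSum w xs ∙ listSum w ys
  listSum-++ w []       ys = ≈-sym (identityˡ _)
  listSum-++ w (x ∷ xs) ys = ≈-trans (∙-congˡ (listSum-++ w xs ys)) (≈-sym (assoc _ _ _))

  listSum-mapMaybe : ∀ {B C : Set} (w : B → Carrier) (g : C → Maybe B) {n} (h : Fin n → C) →
                     listSum w (mapMaybe g (tabulate h)) ≈ sum (λ j → maybe′ w ε (g (h j)))
  listSum-mapMaybe w g {zero}  h = ≈-refl
  listSum-mapMaybe w g {suc n} h with g (h Fin.zero)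
  ... | just x  = ∙-congˡ (listSum-mapMaybe w g (h ∘ Fin.suc))
  ... | nothing = ≈-trans (listSum-mapMaybe w g (h ∘ Fin.suc)) (≈-sym (identityˡ _))

  listSum-concatMap : ∀ {B C : Set} (w : B → Carrier) (g : C → List B) {n} (h : Fin n → C) →
                      listSum w (concatMap g (tabulate h)) ≈ sum (λ i → listSum w (g (h i)))
  listSum-concatMap w g {zero}  h = ≈-refl
  listSum-concatMap w g {suc n} h = ≈-trans (listSum-++ w (g (h Fin.zero)) _)
    (∙-congˡ (listSum-concatMap w g (h ∘ Fin.suc)))

  module Stats {m n N : ℕ} (w : Fin N → Carrier) (A : PFArray m n N) where

    cell : Fin m → Fin n → Carrier
    cell i j = maybe′ w ε (A i j)

    row-sum : ∀ i → listSum w (rowEntries A i) ≈ sum (λ j → cell i j)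
    row-sum i = listSum-mapMaybe w (A i) id

    col-sum : ∀ j → listSum w (colEntries A j) ≈ sum (λ i → cell i j)
    col-sum j = listSum-mapMaybe w (λ i → A i j) id

    all-rows : listSum w (allEntries A) ≈ sum (λ i → listSum w (rowEntries A i))
    all-rows = listSum-concatMap w (rowEntries A) id

    all-cols : listSum w (allEntries A) ≈ sum (λ j → listSum w (colEntries A j))
    all-cols = begin
      listSum w (allEntries A)                  ≈⟨ all-rows ⟩
      sum (λ i → listSum w (rowEntries A i))    ≈⟨ sum-cong-≋ row-sum ⟩
      sum (λ i → sum (λ j → cell i j))          ≈⟨ ∑-comm cell ⟩
      sum (λ j → sum (λ i → cell i j))          ≈⟨ sum-cong-≋ (λ j → ≈-sym (col-sum j)) ⟩
      sum (λ j → listSum w (colEntries A j))    ∎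

  module Placement {m n N : ℕ} (s : ℕ) (col : ℕ → ℕ) (val : ℕ → Fin N)
                   (col<n : ∀ c → col c < n)
                   (distinct : ∀ i → DistinctBelow s (λ a → col (i * s + a)))
                   (w : Fin N → Carrier) where

    array : PFArray m n N
    array i j = find s (λ a → col (toℕ i * s + a)) (λ a → val (toℕ i * s + a)) (toℕ j)

    open Stats w array

    cell-Σ : ∀ i j → cell i j ≈ Σ< s (λ a → δ (col (toℕ i * s + a)) (toℕ j) (w (val (toℕ i * s + a))))
    cell-Σ i j = find-Σ w s _ _ (toℕ j) (distinct (toℕ i))

    row-Σ : ∀ i → listSum w (rowEntries array i) ≈ Σ< s (λ a → w (val (toℕ i * s + a)))
    row-Σ i = begin
      listSum w (rowEntries array i)                                             ≈⟨ row-sum i ⟩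
      sum (λ j → cell i j)                                                       ≈⟨ sum-cong-≋ (cell-Σ i) ⟩
      sum {n} (λ j → Σ< s (λ a → δ (col (toℕ i * s + a)) (toℕ j) (w (val (toℕ i * s + a)))))  ≈⟨ sum-toℕ n _ ⟩
      Σ< n (λ j → Σ< s (λ a → δ (col (toℕ i * s + a)) j (w (val (toℕ i * s + a)))))  ≈⟨ Σ-swap n s _ ⟩
      Σ< s (λ a → Σ< n (λ j → δ (col (toℕ i * s + a)) j (w (val (toℕ i * s + a)))))  ≈⟨ Σ-cong s (λ a _ → Σ-δ′ n _ (λ _ → w (val (toℕ i * s + a))) (col<n _)) ⟩
      Σ< s (λ a → w (val (toℕ i * s + a)))                                       ∎

    all-Σ : listSum w (allEntries array) ≈ Σ< (m * s) (λ c → w (val c))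
    all-Σ = ≈-trans all-rows (≈-trans (sum-cong-≋ row-Σ)
      (≈-trans (sum-toℕ m (λ i → Σ< s (λ a → w (val (i * s + a))))) (≈-sym (Σ-blocks m s (λ c → w (val c))))))

    -- The cells of a column are not consecutive in the cell sequence, so the whole sequence is
    -- filtered by δ; `column-Σ` later evaluates the filter layer by layer.
    col-Σ : ∀ j → listSum w (colEntries array j) ≈ Σ< (m * s) (λ c → δ (col c) (toℕ j) (w (val c)))
    col-Σ j = ≈-trans (col-sum j) (≈-trans (sum-cong-≋ (λ i → cell-Σ i j))
      (≈-trans (sum-toℕ m (λ i → Σ< s (λ a → term (i * s + a)))) (≈-sym (Σ-blocks m s term))))
      where
      term : ℕ → Carrier
      term c = δ (col c) (toℕ j) (w (val c))

-- Arrays and integer lifts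

module ℕΣ = Sums ℕ.+-0-commutativeMonoid
module ℤΣ = Sums ℤ.+-0-commutativeMonoid

-- The modulus `suc N` is a parameter of its own, so that transposition does not turn `n * k` into
-- `m * s`. Row and column sums are recorded over ℤ; `sumMod-zero` derives the modular ones.
record Heffter (m n s k N : ℕ) : Set where
  field
    array        : PFArray m n (suc N)
    row-length   : ∀ i → length (rowEntries array i) ≡ s
    col-length   : ∀ j → length (colEntries array j) ≡ k
    multiplicity : ∀ r → 1 ≤ r → r < suc N → mult r (pmList N (allEntries array)) ≡ 2
    integer      : IsInteger m n N array

length-Σ : ∀ {B : Set} (xs : List B) → length xs ≡ ℕΣ.listSum (λ _ → 1) xs
length-Σ []       = refl
length-Σ (x ∷ xs) = cong suc (length-Σ xs)

pmCount : (N r : ℕ) → Fin (suc N) → ℕ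
pmCount N r x = ℕΣ.δ (toℕ x) r 1 + ℕΣ.δ ((suc N ∸ toℕ x) % suc N) r 1

mult-∷ : ∀ r x xs → mult r (x ∷ xs) ≡ ℕΣ.δ x r 1 + mult r xs
mult-∷ r x xs with x ≡ᵇ r
... | true  = refl
... | false = refl

mult-pmList : ∀ N r xs → mult r (pmList N xs) ≡ ℕΣ.listSum (pmCount N r) xs
mult-pmList N r []       = refl
mult-pmList N r (x ∷ xs) = begin
  mult r (toℕ x ∷ x̄ ∷ pmList N xs)                                        ≡⟨ mult-∷ r (toℕ x) _ ⟩
  ℕΣ.δ (toℕ x) r 1 + mult r (x̄ ∷ pmList N xs)                              ≡⟨ cong (λ y → ℕΣ.δ (toℕ x) r 1 + y) (mult-∷ r x̄ _) ⟩
  ℕΣ.δ (toℕ x) r 1 + (ℕΣ.δ x̄ r 1 + mult r (pmList N xs))                   ≡⟨ ℕ.+-assoc (ℕΣ.δ (toℕ x) r 1) _ _ ⟨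
  pmCount N r x + mult r (pmList N xs)                                     ≡⟨ cong (λ y → pmCount N r x + y) (mult-pmList N r xs) ⟩
  pmCount N r x + ℕΣ.listSum (pmCount N r) xs                              ∎
  where
  open ≡-Reasoning
  x̄ = (suc N ∸ toℕ x) % suc N

sumℤ-lift : ∀ N (xs : List (Fin (suc N))) → sumℤ (map (lift N) xs) ≡ ℤΣ.listSum (lift N) xs
sumℤ-lift N []       = refl
sumℤ-lift N (x ∷ xs) = cong (λ z → lift N x ℤ.+ z) (sumℤ-lift N xs)

-- Only the multiplicity refers to the row-by-row list `allEntries`. Written as a weighted sum of
-- entries, it takes the same value row by row and column by column, by double counting.
transpose : ∀ {m n s k N} → Heffter m n s k N → Heffter n m k s N
transpose {N = N} H = record
  { array        = λ i j → array j i
  ; row-length   = col-length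
  ; col-length   = row-length
  ; multiplicity = λ r 1≤r r≤N → trans (mult-pmList N r (allEntries (λ i j → array j i)))
      (trans (ℕΣ.Stats.all-rows (pmCount N r) (λ i j → array j i))
      (trans (sym (ℕΣ.Stats.all-cols (pmCount N r) array))
      (trans (sym (mult-pmList N r (allEntries array))) (multiplicity r 1≤r r≤N))))
  ; integer      = proj₂ integer , proj₁ integer
  }
  where open Heffter H

lift-residue : ∀ N (x : Fin (suc N)) → ∃ λ e → + toℕ x ≡ lift N x ℤ.+ + (e * suc N)
lift-residue N x with toℕ x ≤ᵇ (suc N / 2)
... | true  = 0 , sym (ℤ.+-identityʳ (+ toℕ x))
... | false = 1 , (begin
  + toℕ x                                            ≡⟨ solve (+ toℕ x) (+ (suc N ∸ toℕ x)) ⟩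
  - + (suc N ∸ toℕ x) ℤ.+ (+ (suc N ∸ toℕ x) ℤ.+ + toℕ x)
    ≡⟨ cong (λ z → - + (suc N ∸ toℕ x) ℤ.+ + z)
         (trans (ℕ.m∸n+n≡m (ℕ.<⇒≤ (toℕ<n x))) (sym (ℕ.*-identityˡ (suc N)))) ⟩
  - + (suc N ∸ toℕ x) ℤ.+ + (1 * suc N)               ∎)
  where
  open ≡-Reasoning
  solve : ∀ a b → a ≡ - b ℤ.+ (b ℤ.+ a)
  solve = ℤSolver.solve-∀

sum-residue : ∀ N (xs : List (Fin (suc N))) →
              ∃ λ e → + ℕList.sum (map toℕ xs) ≡ sumℤ (map (lift N) xs) ℤ.+ + (e * suc N)
sum-residue N []       = 0 , refl
sum-residue N (x ∷ xs) with lift-residue N x | sum-residue N xs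
... | e , p | f , q = e + f , (begin
  + toℕ x ℤ.+ + ℕList.sum (map toℕ xs)                          ≡⟨ cong₂ ℤ._+_ p q ⟩
  (lx ℤ.+ + (e * suc N)) ℤ.+ (ls ℤ.+ + (f * suc N))       ≡⟨ solve lx (+ (e * suc N)) ls (+ (f * suc N)) ⟩
  (lx ℤ.+ ls) ℤ.+ + (e * suc N + f * suc N)               ≡⟨ cong (λ z → (lx ℤ.+ ls) ℤ.+ + z) (ℕ.*-distribʳ-+ (suc N) e f) ⟨
  (lx ℤ.+ ls) ℤ.+ + ((e + f) * suc N)                     ∎)
  where
  open ≡-Reasoning
  lx = lift N x
  ls = sumℤ (map (lift N) xs)
  solve : ∀ a b c d → (a ℤ.+ b) ℤ.+ (c ℤ.+ d) ≡ (a ℤ.+ c) ℤ.+ (b ℤ.+ d)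
  solve = ℤSolver.solve-∀

-- Each residue exceeds its lift by 0 or `suc N`, so a vanishing sum of lifts leaves a natural
-- multiple of `suc N`.
sumMod-zero : ∀ N (xs : List (Fin (suc N))) → sumℤ (map (lift N) xs) ≡ + 0 → sumMod N xs ≡ 0
sumMod-zero N xs Σ≡0 with sum-residue N xs
... | e , p = trans (cong (_% suc N) (ℤ.+-injective
    (trans p (trans (cong (ℤ._+ + (e * suc N)) Σ≡0) (ℤ.+-identityˡ _))))) (m*n%n≡0 e (suc N))

heffter⇒H2 : ∀ {m n s k} → Heffter m n s k (n * k) →
             Σ (PFArray m n (suc (n * k))) (λ A → IsH2 m n s k A × IsInteger m n (n * k) A)
heffter⇒H2 {n = n} {k = k} H = array ,
  (row-length , col-length , multiplicity ,
   (λ i → sumMod-zero (n * k) (rowEntries array i) (proj₁ integer i)) ,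
   (λ j → sumMod-zero (n * k) (colEntries array j) (proj₂ integer j))) , integer
  where open Heffter H

H2⇒heffter : ∀ {m n s k} → Σ (PFArray m n (suc (n * k))) (λ A → IsH2 m n s k A × IsInteger m n (n * k) A) →
             Heffter m n s k (n * k)
H2⇒heffter (A , (rows , cols , mults , _) , int) = record
  { array = A ; row-length = rows ; col-length = cols ; multiplicity = mults ; integer = int }

encode : (N : ℕ) → ℤ → Fin (suc N)
encode N (+ a)    = a mod suc N
-- The integer is -(a + 1), and its residue modulo N + 1 is N - a.
encode N -[1+ a ] = (N ∸ a) mod suc N

toℕ-mod : ∀ {a N} → a ≤ N → toℕ (a mod suc N) ≡ a
toℕ-mod {a} {N} a≤N = trans (toℕ-fromℕ< (m%n<n a (suc N))) (m<n⇒m%n≡m (s≤s a≤N))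

InRange : ℕ → ℕ → Set
InRange E y = 1 ≤ y × y ≤ E

half-odd : ∀ E → suc (E * 2) / 2 ≡ E
half-odd E = trans (+-distrib-/-∣ʳ 1 {E * 2} {2} (divides E refl)) (m*n/n≡m E 2)

E≤E*2 : ∀ E → E ≤ E * 2
E≤E*2 E = ℕ.m≤m*n E 2

-- Residues of negative entries lie strictly above `E`, which is how `lift` tells them from the
-- positive ones.
complement-bound : ∀ {E y} → y < E → E < E * 2 ∸ y
complement-bound {E} {y} y<E = ℕ.m+n≤o⇒m≤o∸n (suc E) (ℕ.≤-trans
  (ℕ.≤-reflexive (sym (ℕ.+-suc E y)))
  (ℕ.≤-trans (ℕ.+-monoʳ-≤ E y<E)
    (ℕ.≤-reflexive (trans (cong (λ z → E + z) (sym (ℕ.+-identityʳ E))) (ℕ.*-comm 2 E)))))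

lift-encode : ∀ E v → InRange E ∣ v ∣ → lift (E * 2) (encode (E * 2) v) ≡ v
lift-encode E (+ a) (_ , a≤E)
  rewrite toℕ-mod {a} {E * 2} (ℕ.≤-trans a≤E (E≤E*2 E)) | half-odd E | dec-true (a ≤? E) a≤E = refl
lift-encode E -[1+ a ] (_ , a<E)
  rewrite toℕ-mod {E * 2 ∸ a} {E * 2} (ℕ.m∸n≤m (E * 2) a) | half-odd E
        | dec-false (E * 2 ∸ a ≤? E) (ℕ.<⇒≱ (complement-bound a<E))
        | ℕ.+-∸-assoc 1 (ℕ.m∸n≤m (E * 2) a)
        | ℕ.m∸[m∸n]≡n (ℕ.≤-trans (ℕ.<⇒≤ a<E) (E≤E*2 E)) = refl

absCount : ℕ → ℕ → ℕ → ℕ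
absCount N r y = ℕΣ.δ y r 1 + ℕΣ.δ (suc N ∸ y) r 1

pmCount-encode : ∀ E r v → InRange E ∣ v ∣ → pmCount (E * 2) r (encode (E * 2) v) ≡ absCount (E * 2) r ∣ v ∣
pmCount-encode E r (+ suc a) (_ , a<E)
  rewrite toℕ-mod {suc a} {E * 2} (ℕ.≤-trans a<E (E≤E*2 E))
        | m<n⇒m%n≡m (s≤s (ℕ.m∸n≤m (E * 2) a)) = refl
pmCount-encode E r -[1+ a ] (_ , a<E)
  rewrite toℕ-mod {E * 2 ∸ a} {E * 2} (ℕ.m∸n≤m (E * 2) a)
        | ℕ.+-∸-assoc 1 (ℕ.m∸n≤m (E * 2) a)
        | ℕ.m∸[m∸n]≡n (ℕ.≤-trans (ℕ.<⇒≤ a<E) (E≤E*2 E))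
        | m<n⇒m%n≡m (s≤s (ℕ.≤-trans a<E (E≤E*2 E))) = ℕ.+-comm (ℕΣ.δ (E * 2 ∸ a) r 1) _

-- The pairs {y, 2E + 1 - y} for y = 1, ..., E partition 1, ..., 2E, so `r` lies in exactly one of
-- them: as the smaller member if `r ≤ E`, otherwise as the larger one.
absCount-sum : ∀ E r → 1 ≤ r → r ≤ E * 2 → ℕΣ.Σ< E (λ y → absCount (E * 2) r (suc y)) ≡ 1
absCount-sum E r@(suc r′) 1≤r r≤2E with r ≤? E
... | yes r≤E = trans (ℕΣ.Σ-∙ E (λ y → ℕΣ.δ (suc y) r 1) (λ y → ℕΣ.δ (E * 2 ∸ y) r 1))
  (cong₂ _+_ (ℕΣ.Σ-δ E r′ (λ _ → 1) r≤E)
    (trans (ℕΣ.Σ-cong E λ y y<E → ℕΣ.δ-≢ 1 (λ eq → ℕ.<⇒≱ (complement-bound y<E) (subst (_≤ E) (sym eq) r≤E)))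
           (ℕΣ.Σ-ε E)))
... | no r≰E = trans (ℕΣ.Σ-∙ E (λ y → ℕΣ.δ (suc y) r 1) (λ y → ℕΣ.δ (E * 2 ∸ y) r 1))
  (cong₂ _+_ (trans (ℕΣ.Σ-cong E λ y y<E → ℕΣ.δ-≢ 1 (λ eq → r≰E (subst (_≤ E) eq y<E))) (ℕΣ.Σ-ε E))
    (trans (ℕΣ.Σ-cong E λ y y<E → cong (λ b → if b then 1 else 0)
             (≡ᵇ-cong⇔ {E * 2 ∸ y} {r} {y} {E * 2 ∸ r}
               (λ eq → trans (sym (ℕ.m∸[m∸n]≡n (ℕ.≤-trans (ℕ.<⇒≤ y<E) (E≤E*2 E)))) (cong (E * 2 ∸_) eq))
               (λ eq → trans (cong (E * 2 ∸_) eq) (ℕ.m∸[m∸n]≡n r≤2E))))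
      -- The summation index is one less than the label, so the label 2E + 1 - r has index 2E - r.
      (ℕΣ.Σ-δ E (E * 2 ∸ r) (λ _ → 1) bound)))
  where
  bound : E * 2 ∸ r < E
  bound = ℕ.+-cancelʳ-< r (E * 2 ∸ r) E (subst (_< E + r) (sym (ℕ.m∸n+n≡m r≤2E))
    (subst (_< E + r) (trans (cong (λ z → E + z) (sym (ℕ.+-identityʳ E))) (ℕ.*-comm 2 E))
      (ℕ.+-monoʳ-< E (ℕ.≰⇒> r≰E))))

-- Equality of all weighted sums encodes that ∣ x 0 ∣ , … , ∣ x (E ∸ 1) ∣ is a permutation of 1 , … , E.
Covers : ℕ → (ℕ → ℤ) → Set
Covers E x = ∀ (f : ℕ → ℕ) → ℕΣ.Σ< E (λ q → f ∣ x q ∣) ≡ ℕΣ.Σ< E (λ y → f (suc y))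

Σ≡0⇒≡0 : ∀ n f → ℕΣ.Σ< n f ≡ 0 → ∀ i → i < n → f i ≡ 0
Σ≡0⇒≡0 (suc n) f Σ≡0 zero    _         = ℕ.m+n≡0⇒m≡0 (f 0) Σ≡0
Σ≡0⇒≡0 (suc n) f Σ≡0 (suc i) (s<s i<n) = Σ≡0⇒≡0 n (f ∘ suc) (ℕ.m+n≡0⇒n≡0 (f 0) Σ≡0) i i<n

inRange? : ∀ E y → Dec (InRange E y)
inRange? E y = (1 ≤? y) ×-dec (y ≤? E)

outside : ℕ → ℕ → ℕ
outside E y = if does (inRange? E y) then 0 else 1

penalty≡0⇒holds : ∀ {P : Set} (P? : Dec P) → (if does P? then 0 else 1) ≡ 0 → P
penalty≡0⇒holds (yes p) _ = p
penalty≡0⇒holds (no _)  ()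

-- Apply `Covers` to the indicator `outside E`: it vanishes on 1, ..., E, hence the sum over `x` is
-- zero and so is each of its terms.
covers⇒inRange : ∀ E x → Covers E x → ∀ q → q < E → InRange E ∣ x q ∣
covers⇒inRange E x cov q q<E = penalty≡0⇒holds (inRange? E ∣ x q ∣) (Σ≡0⇒≡0 E _ Σ-outside q q<E)
  where
  Σ-outside : ℕΣ.Σ< E (λ q → outside E ∣ x q ∣) ≡ 0
  Σ-outside = trans (cov (outside E)) (trans (ℕΣ.Σ-cong E λ y y<E →
    cong (λ b → if b then 0 else 1) (dec-true (inRange? E (suc y)) (s≤s z≤n , y<E))) (ℕΣ.Σ-ε E))

alternate : (ℕ → ℤ) → ℕ → ℤ
alternate x 0             = x 0
alternate x 1             = - x 0
alternate x (suc (suc c)) = alternate (x ∘ suc) c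

alternate-even : ∀ x q → alternate x (q * 2) ≡ x q
alternate-even x zero    = refl
alternate-even x (suc q) = alternate-even (x ∘ suc) q

alternate-odd : ∀ x q → alternate x (suc (q * 2)) ≡ - x q
alternate-odd x zero    = refl
alternate-odd x (suc q) = alternate-odd (x ∘ suc) q

alternate-inRange : ∀ E x E′ → (∀ q → q < E′ → InRange E ∣ x q ∣) → ∀ c → c < E′ * 2 → InRange E ∣ alternate x c ∣
alternate-inRange E x (suc E′) b zero          c<   = b 0 z<s
alternate-inRange E x (suc E′) b (suc zero)    c<   = subst (InRange E) (sym (ℤ.∣-i∣≡∣i∣ (x 0))) (b 0 z<s)
alternate-inRange E x (suc E′) b (suc (suc c)) (s<s (s<s c<)) =
  alternate-inRange E (x ∘ suc) E′ (λ q q< → b (suc q) (s<s q<)) c c<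

-- Arrays from sequences of cells

div-block : ∀ l j n .{{_ : NonZero n}} → j < n → (l * n + j) / n ≡ l
div-block l j n j<n = begin
  (l * n + j) / n       ≡⟨ cong (_/ n) (ℕ.+-comm (l * n) j) ⟩
  (j + l * n) / n       ≡⟨ +-distrib-/-∣ʳ j (divides l refl) ⟩
  j / n + l * n / n     ≡⟨ cong₂ _+_ (m<n⇒m/n≡0 j<n) (m*n/n≡m l n) ⟩
  l                     ∎
  where open ≡-Reasoning

mod-block : ∀ l j n .{{_ : NonZero n}} → j < n → (l * n + j) % n ≡ j
mod-block l j n j<n = begin
  (l * n + j) % n       ≡⟨ cong (_% n) (ℕ.+-comm (l * n) j) ⟩
  (j + l * n) % n       ≡⟨ [m+kn]%n≡m%n j l n ⟩
  j % n                 ≡⟨ m<n⇒m%n≡m j<n ⟩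
  j                     ∎
  where open ≡-Reasoning

column : (n : ℕ) .{{_ : NonZero n}} → (ℕ → ℕ → ℕ) → ℕ → ℕ
column n σ c = σ (c / n) (c % n)

-- Within layer `l` the cell at position `j` is moved to column `σ l j`. Since `σ l` is its own
-- inverse, column `j` conversely reads position `σ l j`, and no separate inverse has to be carried
-- along.
record LayerInvolution (n : ℕ) (σ : ℕ → ℕ → ℕ) : Set where
  field
    involutive : ∀ l j → σ l (σ l j) ≡ j
    preserves< : ∀ l j → j < n → σ l j < n

module LayerSums (CM : CommutativeMonoid 0ℓ 0ℓ) where

  open CommutativeMonoid CM using (Carrier; _≈_; ε; reflexive; setoid)
  open Sums CM
  open SetoidReasoning setoid

  column-Σ : ∀ k n .{{_ : NonZero n}} σ → LayerInvolution n σ → ∀ (w : ℕ → Carrier) j → j < n →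
             Σ< (k * n) (λ c → δ (column n σ c) j (w c)) ≈ Σ< k (λ l → w (l * n + σ l j))
  column-Σ k n σ σ-inv w j j<n = begin
    Σ< (k * n) (λ c → δ (column n σ c) j (w c))                              ≈⟨ Σ-blocks k n _ ⟩
    Σ< k (λ l → Σ< n (λ i → δ (column n σ (l * n + i)) j (w (l * n + i))))   ≈⟨ Σ-cong k (λ l _ → Σ-cong n (λ i i<n → reflexive
                                                                              (cong (λ b → if b then w (l * n + i) else ε) (place l i i<n)))) ⟩
    Σ< k (λ l → Σ< n (λ i → δ i (σ l j) (w (l * n + i))))                    ≈⟨ Σ-cong k (λ l _ → Σ-δ n (σ l j) (λ i → w (l * n + i)) (preserves< l j j<n)) ⟩
    Σ< k (λ l → w (l * n + σ l j))                                           ∎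
    where
    open LayerInvolution σ-inv
    place : ∀ l i → i < n → (column n σ (l * n + i) ≡ᵇ j) ≡ (i ≡ᵇ σ l j)
    place l i i<n rewrite div-block l i n i<n | mod-block l i n i<n =
      ≡ᵇ-cong⇔ (λ eq → trans (sym (involutive l i)) (cong (σ l) eq)) (λ eq → trans (cong (σ l) eq) (involutive l j))

Σ-1 : ∀ n → ℕΣ.Σ< n (λ _ → 1) ≡ n
Σ-1 zero    = refl
Σ-1 (suc n) = cong suc (Σ-1 n)

alternate-shift : ∀ x t a → alternate x (t * 2 + a) ≡ alternate (λ q → x (t + q)) a
alternate-shift x zero    a = refl
alternate-shift x (suc t) a = alternate-shift (x ∘ suc) t a

Σ-alternate : ∀ S x → ℤΣ.Σ< (S * 2) (alternate x) ≡ + 0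
Σ-alternate zero    x = refl
Σ-alternate (suc S) x = trans (cong (λ z → x 0 ℤ.+ (- x 0 ℤ.+ z)) (Σ-alternate S (x ∘ suc))) (solve (x 0))
  where
  solve : ∀ a → a ℤ.+ (- a ℤ.+ + 0) ≡ + 0
  solve = ℤSolver.solve-∀

-- Each absolute value 1, ..., E occurs in two cells, and by `absCount-sum` these contribute 2 to
-- the multiplicity of every nonzero residue. Row windows start at multiples of 2 and cancel pair by
-- pair. What depends on the choice of labels and of `σ` is left to the hypotheses: coverage,
-- distinct columns in each window, balanced columns.
construct : ∀ m n S K .{{_ : NonZero n}} → m * S ≡ n * K →
            ∀ x → Covers (n * K) x → ∀ σ → LayerInvolution n σ →
            (∀ i → DistinctBelow (S * 2) (λ a → column n σ (i * (S * 2) + a))) →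
            (∀ j → j < n → ℤΣ.Σ< (K * 2) (λ l → alternate x (l * n + σ l j)) ≡ + 0) →
            Heffter m n (S * 2) (K * 2) (n * (K * 2))
construct m n S K mS≡nK x cov σ σ-inv distinct balanced =
  subst (Heffter m n s k) (ℕ.*-assoc n K 2) (record
    { array        = array
    ; row-length   = λ i → trans (length-Σ (rowEntries array i)) (trans (ℕP.row-Σ (λ _ → 1) i) (Σ-1 s))
    ; col-length   = λ j → trans (length-Σ (colEntries array j))
        (trans (ℕP.col-Σ (λ _ → 1) j) (trans (ℕ-column (λ _ → 1) j) (Σ-1 k)))
    ; multiplicity = multiplicity
    ; integer      = (λ i → trans (sumℤ-lift N (rowEntries array i)) (trans (ℤP.row-Σ (lift N) i) (row-zero (toℕ i) (toℕ<n i))))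
                   , (λ j → trans (sumℤ-lift N (colEntries array j)) (trans (ℤP.col-Σ (lift N) j)
                       (trans (ℤ-column (lift N) j) (col-zero (toℕ j) (toℕ<n j)))))
    })
  where
  s k E N : ℕ
  s = S * 2
  k = K * 2
  E = n * K
  N = E * 2
  ms≡E2 : m * s ≡ E * 2
  ms≡E2 = trans (sym (ℕ.*-assoc m S 2)) (cong (_* 2) mS≡nK)
  kn≡E2 : k * n ≡ E * 2
  kn≡E2 = trans (ℕ.*-comm k n) (sym (ℕ.*-assoc n K 2))
  ms≡kn : m * s ≡ k * n
  ms≡kn = trans ms≡E2 (sym kn≡E2)
  v : ℕ → ℤ
  v = alternate x
  val : ℕ → Fin (suc N)
  val c = encode N (v c)
  open LayerInvolution σ-inv
  module Placed (CM : CommutativeMonoid 0ℓ 0ℓ) where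
    open Sums CM
    open Placement {m} {n} s (column n σ) val (λ c → preserves< _ _ (m%n<n c n)) distinct public
    open CommutativeMonoid CM using (Carrier; _≈_; reflexive) renaming (trans to ≈-trans)
    to-layers : (w : Fin (suc N) → Carrier) → ∀ (j : Fin n) →
                Σ< (m * s) (λ c → δ (column n σ c) (toℕ j) (w (val c))) ≈ Σ< k (λ l → w (val (l * n + σ l (toℕ j))))
    to-layers w j = ≈-trans (reflexive (cong (λ t → Σ< t (λ c → δ (column n σ c) (toℕ j) (w (val c)))) ms≡kn))
      (LayerSums.column-Σ CM k n σ σ-inv (λ c → w (val c)) (toℕ j) (toℕ<n j))
  module ℕP = Placed ℕ.+-0-commutativeMonoid
  module ℤP = Placed ℤ.+-0-commutativeMonoid
  ℕ-column = ℕP.to-layers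
  ℤ-column = ℤP.to-layers
  array : PFArray m n (suc N)
  -- The weight is only a module parameter; the array is the same for every weight, so a constant
  -- one is chosen.
  array = ℕP.array (λ _ → 1)
  v-inRange : ∀ c → c < m * s → InRange E ∣ v c ∣
  v-inRange c c<ms = alternate-inRange E x E (covers⇒inRange E x cov) c (subst (c <_) ms≡E2 c<ms)
  row-zero : ∀ i → i < m → ℤΣ.Σ< s (λ a → lift N (val (i * s + a))) ≡ + 0
  row-zero i i<m = begin
    ℤΣ.Σ< s (λ a → lift N (val (i * s + a)))        ≡⟨ ℤΣ.Σ-cong s (λ a a<s → lift-encode E _ (v-inRange _ (in-window a a<s))) ⟩
    ℤΣ.Σ< s (λ a → v (i * s + a))                   ≡⟨ ℤΣ.Σ-cong s (λ a a<s → trans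
                                                         (cong (λ t → v (t + a)) (sym (ℕ.*-assoc i S 2))) (alternate-shift x (i * S) a)) ⟩
    ℤΣ.Σ< s (alternate (λ q → x (i * S + q)))       ≡⟨ Σ-alternate S _ ⟩
    + 0                                             ∎
    where
    open ≡-Reasoning
    in-window : ∀ a → a < s → i * s + a < m * s
    in-window a a<s = ℕ.<-≤-trans (ℕ.+-monoʳ-< (i * s) a<s)
      (subst (_≤ m * s) (ℕ.+-comm s (i * s)) (ℕ.*-monoˡ-≤ s i<m))
  col-zero : ∀ j → j < n → ℤΣ.Σ< k (λ l → lift N (val (l * n + σ l j))) ≡ + 0
  col-zero j j<n = trans (ℤΣ.Σ-cong k (λ l l<k → lift-encode E _ (v-inRange _ (in-layer l l<k)))) (balanced j j<n)
    where
    in-layer : ∀ l → l < k → l * n + σ l j < m * s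
    in-layer l l<k = subst (l * n + σ l j <_) (sym ms≡kn) (ℕ.<-≤-trans (ℕ.+-monoʳ-< (l * n) (preserves< l j j<n))
      (subst (_≤ k * n) (ℕ.+-comm n (l * n)) (ℕ.*-monoˡ-≤ n l<k)))
  multiplicity : ∀ r → 1 ≤ r → r < suc N → mult r (pmList N (allEntries array)) ≡ 2
  multiplicity r 1≤r (s≤s r≤N) = begin
    mult r (pmList N (allEntries array))                        ≡⟨ mult-pmList N r (allEntries array) ⟩
    ℕΣ.listSum (pmCount N r) (allEntries array)                 ≡⟨ ℕP.all-Σ (pmCount N r) ⟩
    ℕΣ.Σ< (m * s) (λ c → pmCount N r (val c))                   ≡⟨ ℕΣ.Σ-cong (m * s) (λ c c<ms → pmCount-encode E r (v c) (v-inRange c c<ms)) ⟩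
    ℕΣ.Σ< (m * s) (λ c → φ ∣ v c ∣)                             ≡⟨ cong (λ t → ℕΣ.Σ< t (λ c → φ ∣ v c ∣)) ms≡E2 ⟩
    ℕΣ.Σ< (E * 2) (λ c → φ ∣ v c ∣)                             ≡⟨ Σ-twice E x φ ⟩
    ℕΣ.Σ< E (λ q → φ ∣ x q ∣) + ℕΣ.Σ< E (λ q → φ ∣ x q ∣)       ≡⟨ cong (λ t → t + t) (trans (cov φ) (absCount-sum E r 1≤r r≤N)) ⟩
    2                                                           ∎
    where
    open ≡-Reasoning
    φ : ℕ → ℕ
    φ = absCount N r
    Σ-twice : ∀ E x (f : ℕ → ℕ) → ℕΣ.Σ< (E * 2) (λ c → f ∣ alternate x c ∣) ≡ ℕΣ.Σ< E (λ q → f ∣ x q ∣) + ℕΣ.Σ< E (λ q → f ∣ x q ∣)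
    Σ-twice zero    x f = refl
    Σ-twice (suc E) x f = trans
      (cong₂ (λ a b → f ∣ x 0 ∣ + (f a + b)) (ℤ.∣-i∣≡∣i∣ (x 0)) (Σ-twice E (x ∘ suc) f))
      (rearrange (f ∣ x 0 ∣) (ℕΣ.Σ< E (λ q → f ∣ x (suc q) ∣)))
      where
      rearrange : ∀ a b → a + (a + (b + b)) ≡ (a + b) + (a + b)
      rearrange = ℕSolver.solve-∀

m<[1+m/n]*n : ∀ m n .{{_ : NonZero n}} → m < suc (m / n) * n
m<[1+m/n]*n m n = subst (_< suc (m / n) * n) (sym (m≡m%n+[m/n]*n m n)) (ℕ.+-monoˡ-< (m / n * n) (m%n<n m n))

-- A window of at most n cells meets two layers at most; displacements by 2 are harmless for even n
-- because a window of even size S * 2 > n ∸ 2 is then a whole layer.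
distinct-in-windows : ∀ n S .{{_ : NonZero n}} σ → LayerInvolution n σ → S * 2 ≤ n →
  (∀ l j j′ → σ l j ≡ σ (suc l) j′ → j ≤ j′ ⊎ (j ≤ 2 + j′ × (∃ λ p → n ≡ p * 2))) →
  ∀ i → DistinctBelow (S * 2) (λ a → column n σ (i * (S * 2) + a))
distinct-in-windows n S σ σ-inv s≤n near i a b a<b b<s same =
  by-layer (c / n ℕ.≟ c′ / n) (suc (c / n) ℕ.≟ c′ / n)
  where
  open LayerInvolution σ-inv
  s c c′ : ℕ
  s = S * 2
  c = i * s + a
  c′ = i * s + b
  shift : c′ + a ≡ c + b
  shift = rearrange (i * s) a b
    where
    rearrange : ∀ t a b → (t + b) + a ≡ (t + a) + b
    rearrange = ℕSolver.solve-∀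
  same-layer : c / n ≡ c′ / n → ⊥
  same-layer eq = ℕ.<⇒≢ a<b (ℕ.+-cancelˡ-≡ (i * s) a b (begin
    c                     ≡⟨ m≡m%n+[m/n]*n c n ⟩
    c % n + c / n * n     ≡⟨ cong₂ (λ j l → j + l * n) c%n≡c′%n eq ⟩
    c′ % n + c′ / n * n   ≡⟨ m≡m%n+[m/n]*n c′ n ⟨
    c′                    ∎))
    where
    open ≡-Reasoning
    c%n≡c′%n : c % n ≡ c′ % n
    c%n≡c′%n = trans (sym (involutive (c / n) (c % n)))
      (trans (cong (σ (c / n)) (trans same (cong (λ l → σ l (c′ % n)) (sym eq)))) (involutive (c / n) (c′ % n)))
  next-layer : suc (c / n) ≡ c′ / n → ⊥
  next-layer eq = close (near (c / n) (c % n) (c′ % n) (trans same (cong (λ l → σ l (c′ % n)) (sym eq))))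
    where
    open ℕ.≤-Reasoning
    rearrange : ∀ j′ n t a → j′ + n + a + t ≡ (j′ + (n + t)) + a
    rearrange = ℕSolver.solve-∀
    rearrange′ : ∀ j b t → (j + t) + b ≡ j + b + t
    rearrange′ = ℕSolver.solve-∀
    offset : c′ % n + n + a ≡ c % n + b
    offset = ℕ.+-cancelʳ-≡ (c / n * n) _ _ (begin-equality
      c′ % n + n + a + c / n * n          ≡⟨ rearrange (c′ % n) n (c / n * n) a ⟩
      c′ % n + suc (c / n) * n + a        ≡⟨ cong (λ l → c′ % n + l * n + a) eq ⟩
      c′ % n + c′ / n * n + a             ≡⟨ cong (_+ a) (m≡m%n+[m/n]*n c′ n) ⟨
      c′ + a                              ≡⟨ shift ⟩
      c + b                               ≡⟨ cong (_+ b) (m≡m%n+[m/n]*n c n) ⟩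
      c % n + c / n * n + b               ≡⟨ rearrange′ (c % n) b (c / n * n) ⟩
      c % n + b + c / n * n               ∎)
    n≤ : ∀ d → c % n ≤ d + c′ % n → n ≤ d + b
    n≤ d le = ℕ.+-cancelˡ-≤ (c′ % n) n (d + b) (begin
      c′ % n + n            ≤⟨ ℕ.m≤m+n _ a ⟩
      c′ % n + n + a        ≡⟨ offset ⟩
      c % n + b             ≤⟨ ℕ.+-monoˡ-≤ b le ⟩
      d + c′ % n + b        ≡⟨ cong (_+ b) (ℕ.+-comm d (c′ % n)) ⟩
      c′ % n + d + b        ≡⟨ ℕ.+-assoc (c′ % n) d b ⟩
      c′ % n + (d + b)      ∎)
    close : c % n ≤ c′ % n ⊎ (c % n ≤ 2 + c′ % n × (∃ λ p → n ≡ p * 2)) → ⊥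
    close (inj₁ le)             = ℕ.<⇒≱ (ℕ.<-≤-trans b<s s≤n) (n≤ 0 le)
    close (inj₂ (le , p , n≡p2)) = ℕ.1+n≢n (trans eq (trans (quotient b b<s) (sym (quotient a (ℕ.<-trans a<b b<s)))))
      where
      p<1+S : p < suc S
      p<1+S = ℕ.*-cancelʳ-< 2 p (suc S) (subst (_< suc S * 2) n≡p2 (ℕ.≤-<-trans (n≤ 2 le) (ℕ.+-monoʳ-< 2 b<s)))
      n≡s : n ≡ s
      n≡s = ℕ.≤-antisym (subst (_≤ s) (sym n≡p2) (ℕ.*-monoˡ-≤ 2 (ℕ.≤-pred p<1+S))) s≤n
      quotient : ∀ a → a < s → (i * s + a) / n ≡ i
      quotient a a<s = trans (cong (λ t → (i * t + a) / n) (sym n≡s)) (div-block i a n (subst (a <_) (sym n≡s) a<s))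
  by-layer : Dec (c / n ≡ c′ / n) → Dec (suc (c / n) ≡ c′ / n) → ⊥
  by-layer (yes eq) _        = same-layer eq
  by-layer (no _)   (yes eq) = next-layer eq
  by-layer (no ≢₁)  (no ≢₂)  = ℕ.<⇒≱ c′<c+n (begin
    c + n                         ≤⟨ ℕ.<⇒≤ (ℕ.+-monoˡ-< n (m<[1+m/n]*n c n)) ⟩
    suc (c / n) * n + n           ≡⟨ ℕ.+-comm (suc (c / n) * n) n ⟩
    suc (suc (c / n)) * n         ≤⟨ ℕ.*-monoˡ-≤ n (ℕ.≤∧≢⇒< (ℕ.≤∧≢⇒< (/-monoˡ-≤ n (ℕ.+-monoʳ-≤ (i * s) (ℕ.<⇒≤ a<b))) ≢₁) ≢₂) ⟩
    c′ / n * n                    ≤⟨ ℕ.m≤n+m _ (c′ % n) ⟩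
    c′ % n + c′ / n * n           ≡⟨ m≡m%n+[m/n]*n c′ n ⟨
    c′                            ∎)
    where
    open ℕ.≤-Reasoning
    c′<c+n : c′ < c + n
    c′<c+n = begin-strict
      c′               <⟨ ℕ.+-monoʳ-< (i * s) (ℕ.<-≤-trans b<s s≤n) ⟩
      i * s + n        ≤⟨ ℕ.+-monoˡ-≤ n (ℕ.m≤m+n (i * s) a) ⟩
      c + n            ∎

fixed : ℕ → ℕ → ℕ
fixed _ j = j

fixed-involution : ∀ n → LayerInvolution n fixed
fixed-involution n = record { involutive = λ _ _ → refl ; preserves< = λ _ _ j<n → j<n }

flatten : (w : ℕ) .{{_ : NonZero w}} → (ℕ → ℕ → ℤ) → ℕ → ℤ
flatten w X q = X (q / w) (q % w)

flatten-block : ∀ w .{{_ : NonZero w}} X l i → i < w → flatten w X (l * w + i) ≡ X l i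
flatten-block w X l i i<w = cong₂ X (div-block l i w i<w) (mod-block l i w i<w)

MatrixCovers : (h w a : ℕ) → (ℕ → ℕ → ℤ) → Set
MatrixCovers h w a X = ∀ (f : ℕ → ℕ) →
  ℕΣ.Σ< h (λ l → ℕΣ.Σ< w (λ i → f ∣ X l i ∣)) ≡ ℕΣ.Σ< (h * w) (λ y → f (suc (a + y)))

flatten-covers : ∀ h w .{{_ : NonZero w}} X → MatrixCovers h w 0 X → Covers (h * w) (flatten w X)
flatten-covers h w X cov f = trans (ℕΣ.Σ-blocks h w _)
  (trans (ℕΣ.Σ-cong h λ l _ → ℕΣ.Σ-cong w λ i i<w → cong (λ z → f ∣ z ∣) (flatten-block w X l i i<w)) (cov f))

alternate-cong : ∀ w {x y} → (∀ q → q < w → x q ≡ y q) → ∀ c → c < w * 2 → alternate x c ≡ alternate y c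
alternate-cong (suc w) x≡y zero          _                = x≡y 0 z<s
alternate-cong (suc w) x≡y (suc zero)    _                = cong -_ (x≡y 0 z<s)
alternate-cong (suc w) x≡y (suc (suc c)) (s<s (s<s c<))   = alternate-cong w (λ q q<w → x≡y (suc q) (s<s q<w)) c c<

-- A row of `w` labels occupies `w * 2` consecutive cells: one layer if w = n/2, and two layers if w
-- = n.
alternate-flatten : ∀ w .{{_ : NonZero w}} X l c → c < w * 2 → alternate (flatten w X) (l * w * 2 + c) ≡ alternate (X l) c
alternate-flatten w X l c c< = trans (alternate-shift (flatten w X) (l * w) c)
  (alternate-cong w (λ q q<w → flatten-block w X l q q<w) c c<)

Σ-neg : ∀ n f → ℤΣ.Σ< n (λ i → - f i) ≡ - ℤΣ.Σ< n f
Σ-neg zero    f = refl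
Σ-neg (suc n) f = trans (cong (λ z → - f 0 ℤ.+ z) (Σ-neg n (f ∘ suc))) (sym (ℤ.neg-distrib-+ (f 0) _))

-- Column 2i is column i of `X`, and column 2i + 1 is its negative.
alternate-columns : ∀ k w (X : ℕ → ℕ → ℤ) → (∀ i → i < w → ℤΣ.Σ< k (λ l → X l i) ≡ + 0) →
                    ∀ j → j < w * 2 → ℤΣ.Σ< k (λ l → alternate (X l) j) ≡ + 0
alternate-columns k (suc w) X zeros zero          _              = zeros 0 z<s
alternate-columns k (suc w) X zeros (suc zero)    _              = trans (Σ-neg k (λ l → X l 0)) (cong -_ (zeros 0 z<s))
alternate-columns k (suc w) X zeros (suc (suc j)) (s<s (s<s j<)) =
  alternate-columns k w (λ l i → X l (suc i)) (λ i i<w → zeros (suc i) (s<s i<w)) j j<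

append : ∀ {B : Set} → ℕ → (ℕ → B) → (ℕ → B) → ℕ → B
append zero    f g l       = g l
append (suc h) f g zero    = f 0
append (suc h) f g (suc l) = append h (f ∘ suc) g l

module AppendSums (CM : CommutativeMonoid 0ℓ 0ℓ) where
  open CommutativeMonoid CM using (Carrier; _≈_; _∙_; ∙-congˡ; identityˡ; assoc) renaming (sym to ≈-sym; trans to ≈-trans)
  open Sums CM

  Σ-append : ∀ {B : Set} (w : B → Carrier) h t f g →
             Σ< (h + t) (λ l → w (append h f g l)) ≈ Σ< h (λ l → w (f l)) ∙ Σ< t (λ l → w (g l))
  Σ-append w zero    t f g = ≈-sym (identityˡ _)
  Σ-append w (suc h) t f g = ≈-trans (∙-congˡ (Σ-append w h t (f ∘ suc) g)) (≈-sym (assoc _ _ _))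

module ℕAppend = AppendSums ℕ.+-0-commutativeMonoid
module ℤAppend = AppendSums ℤ.+-0-commutativeMonoid

append-covers : ∀ h t w a X Y → MatrixCovers h w a X → MatrixCovers t w (a + h * w) Y →
                MatrixCovers (h + t) w a (append h X Y)
append-covers h t w a X Y covX covY f = begin
  ℕΣ.Σ< (h + t) (λ l → rowSum (append h X Y l))                    ≡⟨ ℕAppend.Σ-append rowSum h t X Y ⟩
  ℕΣ.Σ< h (rowSum ∘ X) + ℕΣ.Σ< t (rowSum ∘ Y)                      ≡⟨ cong₂ _+_ (covX f) (covY f) ⟩
  ℕΣ.Σ< (h * w) (λ y → f (suc (a + y))) + ℕΣ.Σ< (t * w) (λ y → f (suc (a + h * w + y)))
    ≡⟨ cong (λ z → ℕΣ.Σ< (h * w) (λ y → f (suc (a + y))) + z)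
         (ℕΣ.Σ-cong (t * w) λ y _ → cong (f ∘ suc) (ℕ.+-assoc a (h * w) y)) ⟩
  ℕΣ.Σ< (h * w) (λ y → f (suc (a + y))) + ℕΣ.Σ< (t * w) (λ y → f (suc (a + (h * w + y))))
    ≡⟨ ℕΣ.Σ-++ (h * w) (t * w) _ ⟨
  ℕΣ.Σ< (h * w + t * w) (λ y → f (suc (a + y)))                    ≡⟨ cong (λ z → ℕΣ.Σ< z (λ y → f (suc (a + y)))) (ℕ.*-distribʳ-+ w h t) ⟨
  ℕΣ.Σ< ((h + t) * w) (λ y → f (suc (a + y)))                      ∎
  where
  open ≡-Reasoning
  rowSum : (ℕ → ℤ) → ℕ
  rowSum r = ℕΣ.Σ< w (λ i → f ∣ r i ∣)

-- Label matrices

-- Pulling the offset out of the constructors turns the column sums below into linear identities in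
-- `+ a`.
label⁺ : ∀ a k → + suc (a + k) ≡ + a ℤ.+ + suc k
label⁺ a k = cong +_ (sym (ℕ.+-suc a k))

label⁻ : ∀ a k → -[1+ a + k ] ≡ - (+ a) ℤ.+ -[1+ k ]
label⁻ a k = trans (cong -_ (label⁺ a k)) (ℤ.neg-distrib-+ (+ a) (+ suc k))

quads : (p a : ℕ) → ℕ → ℕ → ℤ
quads p a 0 i = + suc (a + i * 4 + 0)
quads p a 1 i = -[1+ a + i * 4 + 1 ]
quads p a 2 i = -[1+ a + i * 4 + 2 ]
quads p a 3 i = + suc (a + i * 4 + 3)
quads p a (suc (suc (suc (suc l)))) i = quads p (a + p * 4) l i

quads-zero : ∀ t p a i → ℤΣ.Σ< (t * 4) (λ l → quads p a l i) ≡ + 0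
quads-zero zero    p a i = refl
quads-zero (suc t) p a i
  rewrite label⁺ (a + i * 4) 0 | label⁻ (a + i * 4) 1 | label⁻ (a + i * 4) 2 | label⁺ (a + i * 4) 3
        | quads-zero t p (a + p * 4) i = solve (+ (a + i * 4))
  where
  solve : ∀ z → (z ℤ.+ + 1) ℤ.+ ((- z ℤ.+ -[1+ 1 ]) ℤ.+ ((- z ℤ.+ -[1+ 2 ]) ℤ.+ ((z ℤ.+ + 4) ℤ.+ + 0))) ≡ + 0
  solve = ℤSolver.solve-∀

quads-covers : ∀ t p a → MatrixCovers (t * 4) p a (quads p a)
quads-covers t p a f = trans (by-quads t a) (cong (λ E → ℕΣ.Σ< E (λ y → f (suc (a + y)))) (arith t p))
  where
  open ≡-Reasoning
  arith : ∀ t p → t * (p * 4) ≡ t * 4 * p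
  arith = ℕSolver.solve-∀
  rearrange : ∀ a b c d e → a + (b + (c + (d + e))) ≡ (a + (b + (c + d))) + e
  rearrange = ℕSolver.solve-∀
  by-quads : ∀ t a → ℕΣ.Σ< (t * 4) (λ l → ℕΣ.Σ< p (λ i → f ∣ quads p a l i ∣)) ≡ ℕΣ.Σ< (t * (p * 4)) (λ y → f (suc (a + y)))
  by-quads zero    a = refl
  by-quads (suc t) a = begin
    row 0 + (row 1 + (row 2 + (row 3 + rest)))                        ≡⟨ rearrange (row 0) (row 1) (row 2) (row 3) rest ⟩
    (row 0 + (row 1 + (row 2 + row 3))) + rest                        ≡⟨ cong₂ _+_ four (by-quads t (a + p * 4)) ⟩
    ℕΣ.Σ< (p * 4) g + ℕΣ.Σ< (t * (p * 4)) (λ y → f (suc (a + p * 4 + y)))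
      ≡⟨ cong (λ z → ℕΣ.Σ< (p * 4) g + z) (ℕΣ.Σ-cong (t * (p * 4)) λ y _ → cong (f ∘ suc) (ℕ.+-assoc a (p * 4) y)) ⟩
    ℕΣ.Σ< (p * 4) g + ℕΣ.Σ< (t * (p * 4)) (λ y → g (p * 4 + y))       ≡⟨ ℕΣ.Σ-++ (p * 4) (t * (p * 4)) g ⟨
    ℕΣ.Σ< (p * 4 + t * (p * 4)) g                                     ∎
    where
    g : ℕ → ℕ
    g y = f (suc (a + y))
    h : ℕ → ℕ → ℕ
    h b i = f (suc (a + i * 4 + b))
    row : ℕ → ℕ
    row b = ℕΣ.Σ< p (h b)
    rest : ℕ
    rest = ℕΣ.Σ< (t * 4) (λ l → ℕΣ.Σ< p (λ i → f ∣ quads p (a + p * 4) l i ∣))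
    four : row 0 + (row 1 + (row 2 + row 3)) ≡ ℕΣ.Σ< (p * 4) g
    four = sym (begin
      ℕΣ.Σ< (p * 4) g                                                   ≡⟨ ℕΣ.Σ-blocks p 4 g ⟩
      ℕΣ.Σ< p (λ i → ℕΣ.Σ< 4 (λ b → g (i * 4 + b)))                     ≡⟨ ℕΣ.Σ-cong p (λ i _ → ℕΣ.Σ-cong 4 (λ b _ →
                                                                            cong (f ∘ suc) (sym (ℕ.+-assoc a (i * 4) b)))) ⟩
      ℕΣ.Σ< p (λ i → ℕΣ.Σ< 4 (λ b → h b i))                             ≡⟨ ℕΣ.Σ-swap p 4 (λ i b → h b i) ⟩
      row 0 + (row 1 + (row 2 + (row 3 + 0)))                           ≡⟨ cong (λ z → row 0 + (row 1 + (row 2 + z))) (ℕ.+-identityʳ (row 3)) ⟩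
      row 0 + (row 1 + (row 2 + row 3))                                 ∎)

-- Two labels of distinct absolute value cannot cancel, but here each pair contributes -1 to every
-- column. A common column sum is all that odd n requires.
duos : (n a : ℕ) → ℕ → ℕ → ℤ
duos n a 0 i = + suc (a + i * 2 + 0)
duos n a 1 i = -[1+ a + i * 2 + 1 ]
duos n a (suc (suc l)) i = duos n (a + n * 2) l i

duos-sum : ∀ t n a i → ℤΣ.Σ< (t * 2) (λ l → duos n a l i) ≡ - (+ t)
duos-sum zero    n a i = refl
duos-sum (suc t) n a i
  rewrite label⁺ (a + i * 2) 0 | label⁻ (a + i * 2) 1 | duos-sum t n (a + n * 2) i =
  trans (solve (+ (a + i * 2)) (+ t)) (sym (ℤ.neg-distrib-+ (+ 1) (+ t)))
  where
  solve : ∀ z t → (z ℤ.+ + 1) ℤ.+ ((- z ℤ.+ -[1+ 1 ]) ℤ.+ - t) ≡ -[1+ 0 ] ℤ.+ - t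
  solve = ℤSolver.solve-∀

duos-covers : ∀ t n a → MatrixCovers (t * 2) n a (duos n a)
duos-covers t n a f = trans (by-duos t a) (cong (λ E → ℕΣ.Σ< E (λ y → f (suc (a + y)))) (arith t n))
  where
  open ≡-Reasoning
  arith : ∀ t n → t * (n * 2) ≡ t * 2 * n
  arith = ℕSolver.solve-∀
  by-duos : ∀ t a → ℕΣ.Σ< (t * 2) (λ l → ℕΣ.Σ< n (λ i → f ∣ duos n a l i ∣)) ≡ ℕΣ.Σ< (t * (n * 2)) (λ y → f (suc (a + y)))
  by-duos zero    a = refl
  by-duos (suc t) a = begin
    row 0 + (row 1 + rest)                                            ≡⟨ ℕ.+-assoc (row 0) (row 1) rest ⟨
    (row 0 + row 1) + rest                                            ≡⟨ cong₂ _+_ two (by-duos t (a + n * 2)) ⟩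
    ℕΣ.Σ< (n * 2) g + ℕΣ.Σ< (t * (n * 2)) (λ y → f (suc (a + n * 2 + y)))
      ≡⟨ cong (λ z → ℕΣ.Σ< (n * 2) g + z) (ℕΣ.Σ-cong (t * (n * 2)) λ y _ → cong (f ∘ suc) (ℕ.+-assoc a (n * 2) y)) ⟩
    ℕΣ.Σ< (n * 2) g + ℕΣ.Σ< (t * (n * 2)) (λ y → g (n * 2 + y))       ≡⟨ ℕΣ.Σ-++ (n * 2) (t * (n * 2)) g ⟨
    ℕΣ.Σ< (n * 2 + t * (n * 2)) g                                     ∎
    where
    g : ℕ → ℕ
    g y = f (suc (a + y))
    h : ℕ → ℕ → ℕ
    h b i = f (suc (a + i * 2 + b))
    row : ℕ → ℕ
    row b = ℕΣ.Σ< n (h b)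
    rest : ℕ
    rest = ℕΣ.Σ< (t * 2) (λ l → ℕΣ.Σ< n (λ i → f ∣ duos n (a + n * 2) l i ∣))
    two : row 0 + row 1 ≡ ℕΣ.Σ< (n * 2) g
    two = sym (begin
      ℕΣ.Σ< (n * 2) g                                                   ≡⟨ ℕΣ.Σ-blocks n 2 g ⟩
      ℕΣ.Σ< n (λ i → ℕΣ.Σ< 2 (λ b → g (i * 2 + b)))                     ≡⟨ ℕΣ.Σ-cong n (λ i _ → ℕΣ.Σ-cong 2 (λ b _ →
                                                                            cong (f ∘ suc) (sym (ℕ.+-assoc a (i * 2) b)))) ⟩
      ℕΣ.Σ< n (λ i → ℕΣ.Σ< 2 (λ b → h b i))                             ≡⟨ ℕΣ.Σ-swap n 2 (λ i b → h b i) ⟩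
      row 0 + (row 1 + 0)                                               ≡⟨ cong (λ z → row 0 + z) (ℕ.+-identityʳ (row 1)) ⟩
      row 0 + row 1                                                     ∎)

open MonoidSolver ℕ.+-0-commutativeMonoid using (Expr; var; _⊕_; prove) renaming (id to ∅)

-- Lets the monoid solver verify that an explicit list of indices is a permutation: both sides are
-- sums of variables, and variable i stands for the weight of the label i + 1 above the offset. The
-- final unit matches the `0` that ends `Σ<`.
variables : ∀ {n} → List (Fin n) → Expr n
variables = foldr (λ i e → var i ⊕ e) ∅

-- Balanced signs make the zero sums independent of the offset a.
sextetA sextetB : ℕ → ℕ → ℤ
sextetA a 0 = + suc (a + 0)
sextetA a 1 = -[1+ a + 1 ]
sextetA a 2 = + suc (a + 2)
sextetA a 3 = -[1+ a + 3 ]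
sextetA a 4 = + suc (a + 6)
sextetA a 5 = -[1+ a + 4 ]
sextetA a _ = + 0
sextetB a 0 = + suc (a + 8)
sextetB a 1 = -[1+ a + 9 ]
sextetB a 2 = + suc (a + 10)
sextetB a 3 = -[1+ a + 11 ]
sextetB a 4 = + suc (a + 7)
sextetB a 5 = -[1+ a + 5 ]
sextetB a _ = + 0

sextetA-zero : ∀ a → ℤΣ.Σ< 6 (sextetA a) ≡ + 0
sextetA-zero a = trans
  (cong₂ ℤ._+_ (label⁺ a 0) (cong₂ ℤ._+_ (label⁻ a 1) (cong₂ ℤ._+_ (label⁺ a 2) (cong₂ ℤ._+_ (label⁻ a 3) (cong₂ ℤ._+_ (label⁺ a 6) (cong (ℤ._+ + 0) (label⁻ a 4)))))))
  (solve (+ a))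
  where
  solve : ∀ z → (z ℤ.+ + 1) ℤ.+ ((- z ℤ.+ -[1+ 1 ]) ℤ.+ ((z ℤ.+ + 3) ℤ.+ ((- z ℤ.+ -[1+ 3 ]) ℤ.+
          ((z ℤ.+ + 7) ℤ.+ ((- z ℤ.+ -[1+ 4 ]) ℤ.+ + 0))))) ≡ + 0
  solve = ℤSolver.solve-∀

sextetB-zero : ∀ a → ℤΣ.Σ< 6 (sextetB a) ≡ + 0
sextetB-zero a = trans
  (cong₂ ℤ._+_ (label⁺ a 8) (cong₂ ℤ._+_ (label⁻ a 9) (cong₂ ℤ._+_ (label⁺ a 10) (cong₂ ℤ._+_ (label⁻ a 11) (cong₂ ℤ._+_ (label⁺ a 7) (cong (ℤ._+ + 0) (label⁻ a 5)))))))
  (solve (+ a))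
  where
  solve : ∀ z → (z ℤ.+ + 9) ℤ.+ ((- z ℤ.+ -[1+ 9 ]) ℤ.+ ((z ℤ.+ + 11) ℤ.+ ((- z ℤ.+ -[1+ 11 ]) ℤ.+
          ((z ℤ.+ + 8) ℤ.+ ((- z ℤ.+ -[1+ 5 ]) ℤ.+ + 0))))) ≡ + 0
  solve = ℤSolver.solve-∀

sextets-cover : ∀ a (f : ℕ → ℕ) → ℕΣ.Σ< 6 (λ l → f ∣ sextetA a l ∣) + ℕΣ.Σ< 6 (λ l → f ∣ sextetB a l ∣)
                                  ≡ ℕΣ.Σ< 12 (λ y → f (suc (a + y)))
sextets-cover a f = prove 12
  (variables (# 0 ∷ # 1 ∷ # 2 ∷ # 3 ∷ # 6 ∷ # 4 ∷ []) ⊕ variables (# 8 ∷ # 9 ∷ # 10 ∷ # 11 ∷ # 7 ∷ # 5 ∷ []))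
  (variables (allFin 12)) (Vec.tabulate (λ y → f (suc (a + toℕ y))))

sextets : ℕ → ℕ → ℕ → ℤ
sextets a l 0             = sextetA a l
sextets a l 1             = sextetB a l
sextets a l (suc (suc i)) = sextets (a + 12) l i

sextets-zero : ∀ a i → ℤΣ.Σ< 6 (λ l → sextets a l i) ≡ + 0
sextets-zero a zero          = sextetA-zero a
sextets-zero a (suc zero)    = sextetB-zero a
sextets-zero a (suc (suc i)) = sextets-zero (a + 12) i

sextets-columns : ∀ u a (f : ℕ → ℕ) → ℕΣ.Σ< (u * 2) (λ i → ℕΣ.Σ< 6 (λ l → f ∣ sextets a l i ∣)) ≡ ℕΣ.Σ< (u * 12) (λ y → f (suc (a + y)))
sextets-columns zero    a f = refl
sextets-columns (suc u) a f = trans (sym (ℕ.+-assoc A B _)) (trans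
  (cong₂ _+_ (sextets-cover a f) (trans (sextets-columns u (a + 12) f)
    (ℕΣ.Σ-cong (u * 12) λ y _ → cong (f ∘ suc) (ℕ.+-assoc a 12 y))))
  (sym (ℕΣ.Σ-++ 12 (u * 12) (λ y → f (suc (a + y))))))
  where
  A = ℕΣ.Σ< 6 (λ l → f ∣ sextetA a l ∣)
  B = ℕΣ.Σ< 6 (λ l → f ∣ sextetB a l ∣)

sextets-covers : ∀ u a → MatrixCovers 6 (u * 2) a (sextets a)
sextets-covers u a f = trans (ℕΣ.Σ-swap 6 (u * 2) (λ l i → f ∣ sextets a l i ∣)) (trans (sextets-columns u a f)
  (cong (λ E → ℕΣ.Σ< E (λ y → f (suc (a + y)))) (arith u)))
  where
  arith : ∀ u → u * 12 ≡ 6 * (u * 2)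
  arith = ℕSolver.solve-∀

-- Found by computer search: the equations are those of the columns permuted by swap below.
knotX knotY knotZ : ℕ → ℤ
knotX 0 = + 2
knotX 1 = + 18
knotX 2 = -[1+ 9 ]
knotX 3 = -[1+ 6 ]
knotX 4 = + 6
knotX 5 = -[1+ 8 ]
knotX _ = + 0
knotY 0 = -[1+ 16 ]
knotY 1 = + 3
knotY 2 = + 12
knotY 3 = + 5
knotY 4 = -[1+ 3 ]
knotY 5 = -[1+ 13 ]
knotY _ = + 0
knotZ 0 = + 8
knotZ 1 = -[1+ 0 ]
knotZ 2 = -[1+ 14 ]
knotZ 3 = + 13
knotZ 4 = -[1+ 15 ]
knotZ 5 = + 11
knotZ _ = + 0

-- Array columns 0 to 3 carry `knotX`, its negative, `knotY` and its negative. `knotX` and `knotZ`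
-- sum to 0 and `knotY` to -15. Then `swap` exchanges -2 with -17 between columns 1 and 2 in layer
-- 0, and -18 with -3 between columns 1 and 3 in layer 1. This adds 15 to column 2, subtracts 15
-- from column 3 and leaves the sum of column 1 unchanged. The block uses the labels 1 to 18, hence
-- the offset of the sextets.
knot : ℕ → ℕ → ℤ
knot l 0 = knotX l
knot l 1 = knotY l
knot l 2 = knotZ l
knot l (suc (suc (suc i))) = sextets 18 l i

knot-columns : ∀ (f : ℕ → ℕ) → ℕΣ.Σ< 3 (λ i → ℕΣ.Σ< 6 (λ l → f ∣ knot l i ∣)) ≡ ℕΣ.Σ< 18 (λ y → f (suc y))
knot-columns f = prove 18
  (variables (# 1 ∷ # 17 ∷ # 9 ∷ # 6 ∷ # 5 ∷ # 8 ∷ []) ⊕ variables (# 16 ∷ # 2 ∷ # 11 ∷ # 4 ∷ # 3 ∷ # 13 ∷ []) ⊕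
   variables (# 7 ∷ # 0 ∷ # 14 ∷ # 12 ∷ # 15 ∷ # 10 ∷ []) ⊕ ∅)
  (variables (allFin 18)) (Vec.tabulate (λ y → f (suc (toℕ y))))

knot-covers : ∀ u → MatrixCovers 6 (3 + u * 2) 0 knot
knot-covers u f = begin
  ℕΣ.Σ< 6 (λ l → ℕΣ.Σ< (3 + u * 2) (λ i → f ∣ knot l i ∣))      ≡⟨ ℕΣ.Σ-swap 6 (3 + u * 2) (λ l i → f ∣ knot l i ∣) ⟩
  ℕΣ.Σ< (3 + u * 2) (λ i → ℕΣ.Σ< 6 (λ l → f ∣ knot l i ∣))      ≡⟨ ℕΣ.Σ-++ 3 (u * 2) (λ i → ℕΣ.Σ< 6 (λ l → f ∣ knot l i ∣)) ⟩
  _                                                            ≡⟨ cong₂ _+_ (knot-columns f) (sextets-columns u 18 f) ⟩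
  _                                                            ≡⟨ ℕΣ.Σ-++ 18 (u * 12) (f ∘ suc) ⟨
  ℕΣ.Σ< (18 + u * 12) (λ y → f (suc y))                         ≡⟨ cong (λ E → ℕΣ.Σ< E (f ∘ suc)) (arith u) ⟩
  ℕΣ.Σ< (6 * (3 + u * 2)) (λ y → f (suc y))                     ∎
  where
  open ≡-Reasoning
  arith : ∀ u → 18 + u * 12 ≡ 6 * (3 + u * 2)
  arith = ℕSolver.solve-∀

module _ (h : ℕ) where
  private
    n = suc (h * 2)

    n≡ : n ≡ suc h + h
    n≡ = arith h
      where
      arith : ∀ h → suc (h * 2) ≡ suc h + h
      arith = ℕSolver.solve-∀

  data Half : ℕ → Set where
    lower : ∀ i → i < suc h → Half i
    upper : ∀ i → i < h → Half (suc h + i)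

  half : ∀ i → i < n → Half i
  half i i<n with i ≤? h
  ... | yes i≤h = lower i (s≤s i≤h)
  ... | no i≰h with ℕ.m≤n⇒∃[o]m+o≡n (ℕ.≰⇒> i≰h)
  ...   | o , refl = upper o (ℕ.+-cancelˡ-< (suc h) o h (subst (suc h + o <_) n≡ i<n))

  lower-double : ∀ i → i < suc h → (i * 2) % n ≡ i * 2
  lower-double i (s≤s i≤h) = m<n⇒m%n≡m (s≤s (ℕ.*-monoˡ-≤ 2 i≤h))

  upper-double : ∀ i → i < h → ((suc h + i) * 2) % n ≡ suc (i * 2)
  upper-double i i<h = trans (cong (_% n) (arith h i)) (trans ([m+n]%n≡m%n (suc (i * 2)) n)
    (m<n⇒m%n≡m (s≤s (ℕ.*-monoˡ-< 2 i<h))))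
    where
    arith : ∀ h i → (suc h + i) * 2 ≡ suc (i * 2) + suc (h * 2)
    arith = ℕSolver.solve-∀

  lower-rotate : ∀ i → i < suc h → (i + h) % n ≡ i + h
  lower-rotate i i<1+h = m<n⇒m%n≡m (subst (i + h <_) (sym n≡) (ℕ.+-monoˡ-< h i<1+h))

  upper-rotate : ∀ i → i < h → (suc h + i + h) % n ≡ i
  upper-rotate i i<h = trans (cong (_% n) (arith h i)) (trans ([m+n]%n≡m%n i n)
    (m<n⇒m%n≡m (ℕ.<-≤-trans i<h (ℕ.≤-trans (E≤E*2 h) (ℕ.n≤1+n _)))))
    where
    arith : ∀ h i → suc h + i + h ≡ i + suc (h * 2)
    arith = ℕSolver.solve-∀

  -- Modulo `n` both sides are 2i + h. Doubling and rotation wrap around for the same `i`, namely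
  -- those beyond `h`, so the congruence is an equality of numbers.
  double-balance : ∀ i → i < n → (i * 2) % n + h ≡ i + (i + h) % n
  double-balance i i<n with half i i<n
  ... | lower _ i≤h rewrite lower-double i i≤h | lower-rotate i i≤h = arith i h
    where
    arith : ∀ i h → i * 2 + h ≡ i + (i + h)
    arith = ℕSolver.solve-∀
  ... | upper j j<h rewrite upper-double j j<h | upper-rotate j j<h = arith j h
    where
    arith : ∀ j h → suc (j * 2) + h ≡ suc h + j + j
    arith = ℕSolver.solve-∀

  Σ-halves : ∀ g → ℕΣ.Σ< n g ≡ ℕΣ.Σ< (suc h) g + ℕΣ.Σ< h (λ i → g (suc h + i))
  Σ-halves g = trans (cong (λ t → ℕΣ.Σ< t g) n≡) (ℕΣ.Σ-++ (suc h) h g)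

  -- Doubling modulo the odd number `n` sends the lower half to the even residues and the upper half
  -- to the odd ones.
  Σ-double : ∀ g → ℕΣ.Σ< n (λ i → g ((i * 2) % n)) ≡ ℕΣ.Σ< n g
  Σ-double g = begin
    ℕΣ.Σ< n (λ i → g ((i * 2) % n))                                       ≡⟨ Σ-halves (λ i → g ((i * 2) % n)) ⟩
    ℕΣ.Σ< (suc h) (λ i → g ((i * 2) % n)) + ℕΣ.Σ< h (λ i → g (((suc h + i) * 2) % n))
      ≡⟨ cong₂ _+_ (ℕΣ.Σ-cong (suc h) λ i i< → cong g (lower-double i i<)) (ℕΣ.Σ-cong h λ i i< → cong g (upper-double i i<)) ⟩
    ℕΣ.Σ< (suc h) (λ i → g (i * 2)) + odds                                ≡⟨ cong (_+ odds) (ℕΣ.Σ-last h (λ i → g (i * 2))) ⟩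
    ℕΣ.Σ< h (λ i → g (i * 2)) + g (h * 2) + odds                          ≡⟨ rearrange (ℕΣ.Σ< h (λ i → g (i * 2))) (g (h * 2)) odds ⟩
    ℕΣ.Σ< h (λ i → g (i * 2)) + odds + g (h * 2)                          ≡⟨ cong (_+ g (h * 2)) (ℕΣ.Σ-∙ h (λ i → g (i * 2)) (λ i → g (suc (i * 2)))) ⟨
    ℕΣ.Σ< h (λ i → g (i * 2) + g (suc (i * 2))) + g (h * 2)
      ≡⟨ cong (_+ g (h * 2)) (ℕΣ.Σ-cong h λ i _ → cong₂ _+_ (cong g (sym (ℕ.+-identityʳ (i * 2))))
           (trans (sym (ℕ.+-identityʳ _)) (cong (λ z → g z + 0) (ℕ.+-comm 1 (i * 2))))) ⟩
    ℕΣ.Σ< h (λ i → ℕΣ.Σ< 2 (λ b → g (i * 2 + b))) + g (h * 2)             ≡⟨ cong (_+ g (h * 2)) (ℕΣ.Σ-blocks h 2 g) ⟨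
    ℕΣ.Σ< (h * 2) g + g (h * 2)                                           ≡⟨ ℕΣ.Σ-last (h * 2) g ⟨
    ℕΣ.Σ< n g                                                             ∎
    where
    open ≡-Reasoning
    odds = ℕΣ.Σ< h (λ i → g (suc (i * 2)))
    rearrange : ∀ a b c → a + b + c ≡ a + c + b
    rearrange = ℕSolver.solve-∀

  Σ-rotate : ∀ g → ℕΣ.Σ< n (λ i → g ((i + h) % n)) ≡ ℕΣ.Σ< n g
  Σ-rotate g = begin
    ℕΣ.Σ< n (λ i → g ((i + h) % n))                                       ≡⟨ Σ-halves (λ i → g ((i + h) % n)) ⟩
    ℕΣ.Σ< (suc h) (λ i → g ((i + h) % n)) + ℕΣ.Σ< h (λ i → g ((suc h + i + h) % n))
      ≡⟨ cong₂ _+_ (ℕΣ.Σ-cong (suc h) λ i i< → cong g (trans (lower-rotate i i<) (ℕ.+-comm i h)))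
                   (ℕΣ.Σ-cong h λ i i< → cong g (upper-rotate i i<)) ⟩
    ℕΣ.Σ< (suc h) (λ i → g (h + i)) + ℕΣ.Σ< h g                           ≡⟨ ℕ.+-comm (ℕΣ.Σ< (suc h) (λ i → g (h + i))) _ ⟩
    ℕΣ.Σ< h g + ℕΣ.Σ< (suc h) (λ i → g (h + i))                           ≡⟨ ℕΣ.Σ-++ h (suc h) g ⟨
    ℕΣ.Σ< (h + suc h) g                                                   ≡⟨ cong (λ t → ℕΣ.Σ< t g) (trans (ℕ.+-comm h (suc h)) (sym n≡)) ⟩
    ℕΣ.Σ< n g                                                             ∎
    where open ≡-Reasoning

  -- A Kotzig array has permutations of 0, ..., n - 1 as rows and constant column sums. Here the
  -- rows 2i, i and i + h modulo `n` are shifted to three consecutive ranges of labels and receive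
  -- the signs +, -, -, so `double-balance` makes the column sums constant.
  kotzig : ℕ → ℕ → ℤ
  kotzig 0 i = + suc ((i * 2) % n)
  kotzig 1 i = -[1+ n + i ]
  kotzig 2 i = -[1+ n + n + (i + h) % n ]
  kotzig _ i = + 0

  kotzig-sum : ∀ i → i < n → ℤΣ.Σ< 3 (λ l → kotzig l i) ≡ -[1+ 0 ] ℤ.+ - (+ n) ℤ.+ - (+ (n + n)) ℤ.+ - (+ h)
  kotzig-sum i i<n = begin
    ℤΣ.Σ< 3 (λ l → kotzig l i)
      ≡⟨ cong₂ ℤ._+_ (label⁺ 0 a) (cong₂ ℤ._+_ (label⁻′ n i) (cong (ℤ._+ + 0) (label⁻′ (n + n) b))) ⟩
    (+ 1 ℤ.+ + a) ℤ.+ ((-[1+ 0 ] ℤ.+ (- (+ n) ℤ.+ - (+ i))) ℤ.+ ((-[1+ 0 ] ℤ.+ (- (+ (n + n)) ℤ.+ - (+ b))) ℤ.+ + 0))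
      ≡⟨ solve (+ a) (+ b) (+ i) (+ n) (+ (n + n)) (+ h) ⟩
    (-[1+ 0 ] ℤ.+ - (+ n) ℤ.+ - (+ (n + n)) ℤ.+ - (+ h)) ℤ.+ ((+ a ℤ.+ + h) ℤ.+ - (+ i ℤ.+ + b))
      ≡⟨ cong (λ z → c ℤ.+ (+ z ℤ.+ - (+ i ℤ.+ + b))) (double-balance i i<n) ⟩
    c ℤ.+ ((+ i ℤ.+ + b) ℤ.+ - (+ i ℤ.+ + b))
      ≡⟨ trans (cong (λ z → c ℤ.+ z) (ℤ.+-inverseʳ (+ i ℤ.+ + b))) (ℤ.+-identityʳ c) ⟩
    c ∎
    where
    open ≡-Reasoning
    a = (i * 2) % n
    b = (i + h) % n
    c = -[1+ 0 ] ℤ.+ - (+ n) ℤ.+ - (+ (n + n)) ℤ.+ - (+ h)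
    label⁻′ : ∀ a k → -[1+ a + k ] ≡ -[1+ 0 ] ℤ.+ (- (+ a) ℤ.+ - (+ k))
    label⁻′ a k = trans (ℤ.neg-distrib-+ (+ 1) (+ (a + k))) (cong (λ z → -[1+ 0 ] ℤ.+ z) (ℤ.neg-distrib-+ (+ a) (+ k)))
    solve : ∀ a b i n m h →
      (+ 1 ℤ.+ a) ℤ.+ ((-[1+ 0 ] ℤ.+ (- n ℤ.+ - i)) ℤ.+ ((-[1+ 0 ] ℤ.+ (- m ℤ.+ - b)) ℤ.+ + 0)) ≡
      (-[1+ 0 ] ℤ.+ - n ℤ.+ - m ℤ.+ - h) ℤ.+ ((a ℤ.+ h) ℤ.+ - (i ℤ.+ b))
    solve = ℤSolver.solve-∀

  kotzig-covers : MatrixCovers 3 n 0 kotzig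
  kotzig-covers f = begin
    ℕΣ.Σ< n (λ i → f (suc ((i * 2) % n))) + (ℕΣ.Σ< n (λ i → f (suc (n + i))) +
      (ℕΣ.Σ< n (λ i → f (suc (n + n + (i + h) % n))) + 0))
      ≡⟨ cong₂ (λ x y → x + (ℕΣ.Σ< n (λ i → f (suc (n + i))) + (y + 0)))
           (Σ-double (f ∘ suc)) (trans (Σ-rotate (λ i → f (suc (n + n + i))))
             (ℕΣ.Σ-cong n λ i _ → cong (f ∘ suc) (ℕ.+-assoc n n i))) ⟩
    ℕΣ.Σ< n (f ∘ suc) + (ℕΣ.Σ< n (λ i → f (suc (n + i))) + (ℕΣ.Σ< n (λ i → f (suc (n + (n + i)))) + 0))
      ≡⟨ cong (λ z → ℕΣ.Σ< n (f ∘ suc) + (ℕΣ.Σ< n (λ i → f (suc (n + i))) + z))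
           (ℕΣ.Σ-++ n 0 (λ i → f (suc (n + (n + i))))) ⟨
    ℕΣ.Σ< n (f ∘ suc) + (ℕΣ.Σ< n (λ i → f (suc (n + i))) + ℕΣ.Σ< (n + 0) (λ i → f (suc (n + (n + i)))))
      ≡⟨ cong (λ z → ℕΣ.Σ< n (f ∘ suc) + z) (ℕΣ.Σ-++ n (n + 0) (λ i → f (suc (n + i)))) ⟨
    ℕΣ.Σ< n (f ∘ suc) + ℕΣ.Σ< (n + (n + 0)) (λ i → f (suc (n + i)))
      ≡⟨ ℕΣ.Σ-++ n (n + (n + 0)) (f ∘ suc) ⟨
    ℕΣ.Σ< (3 * n) (f ∘ suc) ∎
    where open ≡-Reasoning

-- Existence, by the residues of n and K

data Parity : ℕ → Set where
  even : ∀ i → Parity (i * 2)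
  odd  : ∀ i → Parity (suc (i * 2))

parity : ∀ n → Parity n
parity zero    = even 0
parity (suc n) with parity n
... | even i = odd i
... | odd i  = even (suc i)

fixed-near : ∀ (j j′ n : ℕ) → j ≡ j′ → j ≤ j′ ⊎ (j ≤ 2 + j′ × (∃ λ p → n ≡ p * 2))
fixed-near j j′ n j≡j′ = inj₁ (ℕ.≤-reflexive j≡j′)

-- With an odd number of columns, column j meets the pairs of cells in two columns of X, with opposite signs.
odd-columns : ∀ m h S K → m * S ≡ suc (h * 2) * K → S * 2 ≤ suc (h * 2) →
              ∀ X c → MatrixCovers K (suc (h * 2)) 0 X →
              (∀ i → i < suc (h * 2) → ℤΣ.Σ< K (λ l → X l i) ≡ c) →
              Heffter m (suc (h * 2)) (S * 2) (K * 2) (suc (h * 2) * (K * 2))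
odd-columns m h S K mS≡nK s≤n X c cov sums =
  construct m n S K mS≡nK (flatten n X)
    (subst (λ E → Covers E (flatten n X)) (ℕ.*-comm K n) (flatten-covers K n X cov))
    fixed (fixed-involution n)
    (distinct-in-windows n S fixed (fixed-involution n) s≤n (λ l j j′ → fixed-near j j′ n))
    balanced
  where
  n = suc (h * 2)
  pair-zero : ∀ j → j < n → ℤΣ.Σ< K (λ l → alternate (X l) j ℤ.+ alternate (X l) (n + j)) ≡ + 0
  pair-zero j j<n with parity j
  ... | even i = begin
    ℤΣ.Σ< K (λ l → alternate (X l) (i * 2) ℤ.+ alternate (X l) (n + i * 2))
      ≡⟨ ℤΣ.Σ-cong K (λ l _ → cong₂ ℤ._+_ (alternate-even (X l) i)
           (trans (cong (λ t → alternate (X l) (suc t)) (sym (ℕ.*-distribʳ-+ 2 h i))) (alternate-odd (X l) (h + i)))) ⟩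
    ℤΣ.Σ< K (λ l → X l i ℤ.+ - X l (h + i))
      ≡⟨ trans (ℤΣ.Σ-∙ K (λ l → X l i) (λ l → - X l (h + i))) (cong₂ ℤ._+_ (sums i i<n) (trans (Σ-neg K (λ l → X l (h + i))) (cong -_ (sums (h + i) h+i<n)))) ⟩
    c ℤ.+ - c    ≡⟨ ℤ.+-inverseʳ c ⟩
    + 0          ∎
    where
    open ≡-Reasoning
    i≤h : i ≤ h
    i≤h = ℕ.*-cancelʳ-≤ i h 2 (ℕ.≤-pred j<n)
    i<n : i < n
    i<n = s≤s (ℕ.≤-trans i≤h (E≤E*2 h))
    h+i<n : h + i < n
    h+i<n = s≤s (subst (h + i ≤_) (trans (cong (λ t → h + t) (sym (ℕ.+-identityʳ h))) (ℕ.*-comm 2 h)) (ℕ.+-monoʳ-≤ h i≤h))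
  ... | odd i = begin
    ℤΣ.Σ< K (λ l → alternate (X l) (suc (i * 2)) ℤ.+ alternate (X l) (n + suc (i * 2)))
      ≡⟨ ℤΣ.Σ-cong K (λ l _ → cong₂ ℤ._+_ (alternate-odd (X l) i)
           (trans (cong (alternate (X l)) (arith h i)) (alternate-even (X l) (suc h + i)))) ⟩
    ℤΣ.Σ< K (λ l → - X l i ℤ.+ X l (suc h + i))
      ≡⟨ trans (ℤΣ.Σ-∙ K (λ l → - X l i) (λ l → X l (suc h + i))) (cong₂ ℤ._+_ (trans (Σ-neg K (λ l → X l i)) (cong -_ (sums i i<n))) (sums (suc h + i) h+i<n)) ⟩
    - c ℤ.+ c    ≡⟨ ℤ.+-inverseˡ c ⟩
    + 0          ∎
    where
    open ≡-Reasoning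
    arith : ∀ h i → suc (h * 2) + suc (i * 2) ≡ (suc h + i) * 2
    arith = ℕSolver.solve-∀
    i<h : i < h
    i<h = ℕ.*-cancelʳ-< 2 i h (ℕ.≤-pred j<n)
    i<n : i < n
    i<n = ℕ.<-trans i<h (s≤s (E≤E*2 h))
    h+i<n : suc h + i < n
    h+i<n = s≤s (subst (h + i <_) (trans (cong (λ t → h + t) (sym (ℕ.+-identityʳ h))) (ℕ.*-comm 2 h)) (ℕ.+-monoʳ-< h i<h))
  balanced : ∀ j → j < n → ℤΣ.Σ< (K * 2) (λ l → alternate (flatten n X) (l * n + j)) ≡ + 0
  balanced j j<n = begin
    ℤΣ.Σ< (K * 2) (λ l → v (l * n + j))
      ≡⟨ ℤΣ.Σ-blocks K 2 (λ l → v (l * n + j)) ⟩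
    ℤΣ.Σ< K (λ l → v ((l * 2 + 0) * n + j) ℤ.+ (v ((l * 2 + 1) * n + j) ℤ.+ + 0))
      ≡⟨ ℤΣ.Σ-cong K (λ l _ → cong₂ ℤ._+_
           (trans (cong v (arith₀ l n j)) (alternate-flatten n X l j (ℕ.<-≤-trans j<n (E≤E*2 n))))
           (trans (ℤ.+-identityʳ _) (trans (cong v (arith₁ l n j)) (alternate-flatten n X l (n + j) n+j<)))) ⟩
    ℤΣ.Σ< K (λ l → alternate (X l) j ℤ.+ alternate (X l) (n + j))
      ≡⟨ pair-zero j j<n ⟩
    + 0 ∎
    where
    open ≡-Reasoning
    v = alternate (flatten n X)
    arith₀ : ∀ l n j → (l * 2 + 0) * n + j ≡ l * n * 2 + j
    arith₀ = ℕSolver.solve-∀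
    arith₁ : ∀ l n j → (l * 2 + 1) * n + j ≡ l * n * 2 + (n + j)
    arith₁ = ℕSolver.solve-∀
    n+j< : n + j < n * 2
    n+j< = subst (n + j <_) (trans (cong (λ t → n + t) (sym (ℕ.+-identityʳ n))) (ℕ.*-comm 2 n)) (ℕ.+-monoʳ-< n j<n)

even-columns : ∀ m p S K .{{_ : NonZero p}} .{{_ : NonZero (p * 2)}} → m * S ≡ p * 2 * K → S * 2 ≤ p * 2 →
               ∀ X → MatrixCovers (K * 2) p 0 X →
               ∀ σ → LayerInvolution (p * 2) σ →
               (∀ l j j′ → σ l j ≡ σ (suc l) j′ → j ≤ j′ ⊎ (j ≤ 2 + j′ × (∃ λ q → p * 2 ≡ q * 2))) →
               (∀ j → j < p * 2 → ℤΣ.Σ< (K * 2) (λ l → alternate (X l) (σ l j)) ≡ + 0) →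
               Heffter m (p * 2) (S * 2) (K * 2) (p * 2 * (K * 2))
even-columns m p S K mS≡nK s≤n X cov σ σ-inv near zeros =
  construct m n S K mS≡nK (flatten p X)
    (subst (λ E → Covers E (flatten p X)) (arith K p) (flatten-covers (K * 2) p X cov))
    σ σ-inv (distinct-in-windows n S σ σ-inv s≤n near)
    (λ j j<n → trans (ℤΣ.Σ-cong (K * 2) λ l _ →
        trans (cong (λ t → alternate (flatten p X) (t + σ l j)) (sym (ℕ.*-assoc l p 2)))
              (alternate-flatten p X l (σ l j) (preserves< l j j<n)))
      (zeros j j<n))
  where
  open LayerInvolution σ-inv
  n = p * 2
  arith : ∀ K p → K * 2 * p ≡ p * 2 * K
  arith = ℕSolver.solve-∀

even-columns-fixed : ∀ m p S K .{{_ : NonZero p}} .{{_ : NonZero (p * 2)}} → m * S ≡ p * 2 * K → S * 2 ≤ p * 2 →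
                     ∀ X → MatrixCovers (K * 2) p 0 X → (∀ i → ℤΣ.Σ< (K * 2) (λ l → X l i) ≡ + 0) →
                     Heffter m (p * 2) (S * 2) (K * 2) (p * 2 * (K * 2))
even-columns-fixed m p S K mS≡nK s≤n X cov zeros =
  even-columns m p S K mS≡nK s≤n X cov fixed (fixed-involution (p * 2)) (λ l j j′ → fixed-near j j′ (p * 2))
    (alternate-columns (K * 2) p X (λ i _ → zeros i))

-- For n ≡ 2 (mod 4) and K odd, n * K ≡ 2 (mod 4), so the sum of the labels is odd; if every pair met one
-- even and one odd column, the sum over the even columns would make it even. The two swaps create odd cycles.
swap : ℕ → ℕ → ℕ
swap 0 1 = 2
swap 0 2 = 1
swap 1 1 = 3
swap 1 3 = 1
swap _ j = j

swap-involutive : ∀ l j → swap l (swap l j) ≡ j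
swap-involutive 0 0 = refl
swap-involutive 0 1 = refl
swap-involutive 0 2 = refl
swap-involutive 0 (suc (suc (suc j))) = refl
swap-involutive 1 0 = refl
swap-involutive 1 1 = refl
swap-involutive 1 2 = refl
swap-involutive 1 3 = refl
swap-involutive 1 (suc (suc (suc (suc j)))) = refl
swap-involutive (suc (suc l)) j = refl

swap-< : ∀ n l j → j < 4 + n → swap l j < 4 + n
swap-< n 0 0 j< = j<
swap-< n 0 1 j< = s≤s (s≤s (s≤s z≤n))
swap-< n 0 2 j< = s≤s (s≤s z≤n)
swap-< n 0 (suc (suc (suc j))) j< = j<
swap-< n 1 0 j< = j<
swap-< n 1 1 j< = s≤s (s≤s (s≤s (s≤s z≤n)))
swap-< n 1 2 j< = j<
swap-< n 1 3 j< = s≤s (s≤s z≤n)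
swap-< n 1 (suc (suc (suc (suc j)))) j< = j<
swap-< n (suc (suc l)) j j< = j<

-- A column shared by two successive layers moves back by at most two positions, from 3 to 1. This
-- is the slack that `distinct-in-windows` allows for even n.
swap-near : ∀ l j → j ≤ 2 + swap (suc l) (swap l j)
swap-near 0 0 = z≤n
swap-near 0 1 = s≤s z≤n
swap-near 0 2 = s≤s (s≤s z≤n)
swap-near 0 3 = ℕ.≤-refl
swap-near 0 (suc (suc (suc (suc j)))) = ℕ.m≤n+m _ 2
swap-near 1 0 = z≤n
swap-near 1 1 = s≤s z≤n
swap-near 1 2 = s≤s (s≤s z≤n)
swap-near 1 3 = ℕ.≤-refl
swap-near 1 (suc (suc (suc (suc j)))) = ℕ.m≤n+m _ 2
swap-near (suc (suc l)) j = ℕ.m≤n+m j 2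

exists-K-even : ∀ m n S t .{{_ : NonZero n}} → m * S ≡ n * (t * 2) → S * 2 ≤ n →
                Heffter m n (S * 2) (t * 2 * 2) (n * (t * 2 * 2))
exists-K-even m n S t mS≡nK s≤n with parity n
exists-K-even m _ S t mS≡nK s≤n | even p@(suc _) =
  even-columns-fixed m p S (t * 2) mS≡nK s≤n (quads p 0)
    (subst (λ k → MatrixCovers k p 0 (quads p 0)) (sym (ℕ.*-assoc t 2 2)) (quads-covers t p 0))
    (λ i → trans (cong (λ k → ℤΣ.Σ< k (λ l → quads p 0 l i)) (ℕ.*-assoc t 2 2)) (quads-zero t p 0 i))
... | odd h = odd-columns m h S (t * 2) mS≡nK s≤n (duos (suc (h * 2)) 0) (- (+ t))
    (duos-covers t (suc (h * 2)) 0) (λ i _ → duos-sum t (suc (h * 2)) 0 i)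

module _ (t : ℕ) where
  private
    K = 3 + t * 2

    K*2≡ : 6 + t * 4 ≡ K * 2
    K*2≡ = cong (λ z → 6 + z) (sym (ℕ.*-assoc t 2 2))

  exists-n-odd : ∀ m h S → m * S ≡ suc (h * 2) * K → S * 2 ≤ suc (h * 2) →
                 Heffter m (suc (h * 2)) (S * 2) (K * 2) (suc (h * 2) * (K * 2))
  exists-n-odd m h S mS≡nK s≤n = odd-columns m h S K mS≡nK s≤n (append 3 (kotzig h) tail) _
    (append-covers 3 (t * 2) n 0 (kotzig h) tail (kotzig-covers h) (duos-covers t n (3 * n)))
    (λ i i<n → trans (ℤAppend.Σ-append (λ r → r i) 3 (t * 2) (kotzig h) tail)
      (cong₂ ℤ._+_ (kotzig-sum h i i<n) (duos-sum t n (3 * n) i)))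
    where
    n = suc (h * 2)
    tail = duos n (3 * n)

  exists-4∣n : ∀ m u S .{{_ : NonZero u}} → m * S ≡ u * 2 * 2 * K → S * 2 ≤ u * 2 * 2 →
               Heffter m (u * 2 * 2) (S * 2) (K * 2) (u * 2 * 2 * (K * 2))
  exists-4∣n m u@(suc _) S mS≡nK s≤n = even-columns-fixed m p S K mS≡nK s≤n (append 6 (sextets 0) tail)
    (subst (λ k → MatrixCovers k p 0 (append 6 (sextets 0) tail)) K*2≡
      (append-covers 6 (t * 4) p 0 (sextets 0) tail (sextets-covers u 0) (quads-covers t p (6 * p))))
    (λ i → trans (cong (λ k → ℤΣ.Σ< k (λ l → append 6 (sextets 0) tail l i)) (sym K*2≡))
      (trans (ℤAppend.Σ-append (λ r → r i) 6 (t * 4) (sextets 0) tail)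
        (cong₂ ℤ._+_ (sextets-zero 0 i) (quads-zero t p (6 * p) i))))
    where
    p = u * 2
    tail = quads p (6 * p)

  exists-n≡2mod4 : ∀ m u S → m * S ≡ (3 + u * 2) * 2 * K → S * 2 ≤ (3 + u * 2) * 2 →
                   Heffter m ((3 + u * 2) * 2) (S * 2) (K * 2) ((3 + u * 2) * 2 * (K * 2))
  exists-n≡2mod4 m u S mS≡nK s≤n = even-columns m p S K mS≡nK s≤n X
    (subst (λ k → MatrixCovers k p 0 X) K*2≡
      (append-covers 6 (t * 4) p 0 knot tail (knot-covers u) (quads-covers t p (6 * p))))
    swap (record { involutive = swap-involutive ; preserves< = swap-< (2 + u * 2 * 2) })
    (λ l j j′ eq → inj₂ (subst (λ i → j ≤ 2 + i) (trans (cong (swap (suc l)) eq) (swap-involutive (suc l) j′)) (swap-near l j) , p , refl))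
    (λ j j<n → trans (cong (λ k → ℤΣ.Σ< k (λ l → alternate (X l) (swap l j))) (sym K*2≡)) (zeros j j<n))
    where
    p = 3 + u * 2
    tail = quads p (6 * p)
    X = append 6 knot tail
    tail-zero : ∀ j → j < p * 2 → ℤΣ.Σ< (t * 4) (λ l → alternate (tail l) j) ≡ + 0
    tail-zero = alternate-columns (t * 4) p tail (λ i _ → quads-zero t p (6 * p) i)
    knot-tail-zero : ∀ i → ℤΣ.Σ< (6 + t * 4) (λ l → X l (2 + i)) ≡ + 0
    knot-tail-zero i = trans (ℤAppend.Σ-append (λ r → r (2 + i)) 6 (t * 4) knot tail)
      (cong₂ ℤ._+_ (knot-zero i) (quads-zero t p (6 * p) (2 + i)))
      where
      knot-zero : ∀ i → ℤΣ.Σ< 6 (λ l → knot l (2 + i)) ≡ + 0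
      knot-zero zero    = refl
      knot-zero (suc i) = sextets-zero 18 i
    zeros : ∀ j → j < p * 2 → ℤΣ.Σ< (6 + t * 4) (λ l → alternate (X l) (swap l j)) ≡ + 0
    -- The six layers of the knot are closed integers in columns 0 to 3; once the tail is rewritten
    -- to zero, the sum computes.
    zeros 0 j<n rewrite tail-zero 0 j<n = refl
    zeros 1 j<n rewrite tail-zero 1 j<n = refl
    zeros 2 j<n rewrite tail-zero 2 j<n = refl
    zeros 3 j<n rewrite tail-zero 3 j<n = refl
    -- From column 4 on `swap` is the identity, and the two label columns `knotX` and `knotY` have
    -- been passed.
    zeros (suc (suc (suc (suc j)))) (s<s (s<s (s<s (s<s j<)))) =
      alternate-columns (6 + t * 4) (1 + u * 2) (λ l i → X l (2 + i)) (λ i _ → knot-tail-zero i) j j<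

-- The lower bound excludes n = 2, the case in which `two-columns` forbids odd K.
exists-K-odd : ∀ m n S t → 3 ≤ n → m * S ≡ n * (3 + t * 2) → S * 2 ≤ n →
               Heffter m n (S * 2) ((3 + t * 2) * 2) (n * ((3 + t * 2) * 2))
exists-K-odd m n S t 3≤n mS≡nK s≤n with parity n
... | odd h = exists-n-odd t m h S mS≡nK s≤n
... | even p with parity p
...   | even u@(suc _)       = exists-4∣n t m u S mS≡nK s≤n
...   | odd zero             = ⊥-elim (ℕ.<⇒≱ 3≤n ℕ.≤-refl)
...   | odd (suc u)          = exists-n≡2mod4 t m u S mS≡nK s≤n
exists-K-odd m _ S t () _ _ | even .0 | even zero

4∤odd*2 : ∀ t → ¬ (4 ∣ suc (t * 2) * 2)
4∤odd*2 t (divides q eq) = ℕ.even≢odd q t (trans (ℕ.*-comm 2 q)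
  (trans (ℕ.*-cancelʳ-≡ (q * 2) (suc (t * 2)) 2 (trans (ℕ.*-assoc q 2 2) (sym eq))) (cong suc (ℕ.*-comm t 2))))

-- For K = 1 the label matrix would have only one or two rows, and labels of distinct absolute value
-- neither agree nor cancel. Transposing exchanges K with S, and S = K = 1 contradicts the condition
-- on s = 2.
exists : ∀ m n S K → 0 < m → 0 < n → m * S ≡ n * K → S * 2 ≤ n → K * 2 ≤ m → 0 < S → 0 < K →
         (S ≡ 1 → (n ≡ 2 × 4 ∣ K * 2) ⊎ (3 ≤ n × 3 ≤ K * 2)) →
         (K ≡ 1 → (m ≡ 2 × 4 ∣ S * 2) ⊎ (3 ≤ m × 3 ≤ S * 2)) →
         Heffter m n (S * 2) (K * 2) (n * (K * 2))
exists m n S K 0<m 0<n mS≡nK s≤n k≤m 0<S 0<K s=2 k=2 with parity K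
... | even t = exists-K-even m n S t {{>-nonZero 0<n}} mS≡nK s≤n
... | odd (suc t) = exists-K-odd m n S t 3≤n mS≡nK s≤n
  where
  3≤n : 3 ≤ n
  3≤n with 3 ≤? n
  ... | yes le = le
  -- From `n ≤ 2` follows S = 1; the first alternative for s = 2 then requires 4 to divide k,
  -- although K is odd.
  ... | no 3≰n with s=2 (ℕ.≤-antisym (ℕ.*-cancelʳ-≤ S 1 2 (ℕ.≤-trans s≤n (ℕ.≤-pred (ℕ.≰⇒> 3≰n)))) 0<S)
  ...   | inj₁ (_ , 4∣k) = ⊥-elim (4∤odd*2 (suc t) 4∣k)
  ...   | inj₂ (le , _)  = le
... | odd zero with parity S
...   | even t = swapRoles (exists-K-even n m 1 t {{>-nonZero 0<m}} (sym mS≡nK) k≤m)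
  where
  swapRoles : Heffter n m 2 (t * 2 * 2) (m * (t * 2 * 2)) → Heffter m n (t * 2 * 2) 2 (n * 2)
  swapRoles H = subst (Heffter m n _ 2) (trans (sym (ℕ.*-assoc m (t * 2) 2)) (trans (cong (_* 2) mS≡nK) (ℕ.*-assoc n 1 2))) (transpose H)
...   | odd (suc t) = swapRoles (exists-K-odd n m 1 t 3≤m (sym mS≡nK) k≤m)
  where
  swapRoles : Heffter n m 2 ((3 + t * 2) * 2) (m * ((3 + t * 2) * 2)) → Heffter m n ((3 + t * 2) * 2) 2 (n * 2)
  swapRoles H = subst (Heffter m n _ 2) (trans (sym (ℕ.*-assoc m (3 + t * 2) 2)) (trans (cong (_* 2) mS≡nK) (ℕ.*-assoc n 1 2))) (transpose H)
  3≤m : 3 ≤ m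
  3≤m with k=2 refl
  ... | inj₁ (_ , 4∣s) = ⊥-elim (4∤odd*2 (suc t) 4∣s)
  ... | inj₂ (le , _)  = le
...   | odd zero with s=2 refl
...     | inj₁ (_ , 4∣2) = ⊥-elim (4∤odd*2 0 4∣2)
...     | inj₂ (_ , s≤s (s≤s ()))

-- Necessity

module ℕSum = CMSum ℕ.+-0-commutativeMonoid

sum-const : ∀ {n} (f : Fin n → ℕ) {s} → (∀ i → f i ≡ s) → ℕSum.sum f ≡ n * s
sum-const {zero}  f f≡s = refl
sum-const {suc n} f f≡s = cong₂ _+_ (f≡s Fin.zero) (sum-const (f ∘ Fin.suc) (f≡s ∘ Fin.suc))

sum-mono : ∀ {n} (f g : Fin n → ℕ) → (∀ i → f i ≤ g i) → ℕSum.sum f ≤ ℕSum.sum g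
sum-mono {zero}  f g f≤g = z≤n
sum-mono {suc n} f g f≤g = ℕ.+-mono-≤ (f≤g Fin.zero) (sum-mono (f ∘ Fin.suc) (g ∘ Fin.suc) (f≤g ∘ Fin.suc))

term≤sum : ∀ {n} (f : Fin n → ℕ) i → f i ≤ ℕSum.sum f
term≤sum f Fin.zero    = ℕ.m≤m+n _ _
term≤sum f (Fin.suc i) = ℕ.≤-trans (term≤sum (f ∘ Fin.suc) i) (ℕ.m≤n+m _ _)

-- Row `i` and column `j` share a single cell, and each further cell of the column is bounded by the
-- sum of its own row.
row+col≤total : ∀ {m n} (c : Fin m → Fin n → ℕ) i j →
  ℕSum.sum (c i) + ℕSum.sum (λ i → c i j) ≤ ℕSum.sum (λ i → ℕSum.sum (c i)) + c i j
row+col≤total {suc m} c i j = begin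
  R i + ℕSum.sum C                          ≡⟨ cong (λ z → R i + z) (ℕSum.sum-remove {i = i} C) ⟩
  R i + (c i j + ℕSum.sum (removeAt C i))   ≤⟨ ℕ.+-monoʳ-≤ (R i) (ℕ.+-monoʳ-≤ (c i j) (sum-mono _ _ λ i′ → term≤sum (c (Fin.punchIn i i′)) j)) ⟩
  R i + (c i j + ℕSum.sum (removeAt R i))   ≡⟨ rearrange (R i) (c i j) (ℕSum.sum (removeAt R i)) ⟩
  R i + ℕSum.sum (removeAt R i) + c i j     ≡⟨ cong (λ z → z + c i j) (ℕSum.sum-remove {i = i} R) ⟨
  ℕSum.sum R + c i j                        ∎
  where
  open ℕ.≤-Reasoning
  R = λ i → ℕSum.sum (c i)
  C = λ i → c i j
  rearrange : ∀ a b d → a + (b + d) ≡ a + d + b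
  rearrange = ℕSolver.solve-∀

-- Grouping the list by values leads from the multiplicities in the definition back to weighted
-- sums.
listSum-mult : ∀ M (g : ℕ → ℕ) (xs : List ℕ) → All (_< M) xs → ℕΣ.listSum g xs ≡ ℕΣ.Σ< M (λ r → g r * mult r xs)
listSum-mult M g []       []           = sym (trans (ℕΣ.Σ-cong M λ r _ → ℕ.*-zeroʳ (g r)) (ℕΣ.Σ-ε M))
listSum-mult M g (x ∷ xs) (x<M ∷ xs<M) = sym (begin
  ℕΣ.Σ< M (λ r → g r * mult r (x ∷ xs))
    ≡⟨ ℕΣ.Σ-cong M (λ r _ → trans (cong (λ z → g r * z) (mult-∷ r x xs))
         (trans (ℕ.*-distribˡ-+ (g r) (ℕΣ.δ x r 1) _) (cong (λ z → z + g r * mult r xs) (scale (x ≡ᵇ r) (g r))))) ⟩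
  ℕΣ.Σ< M (λ r → ℕΣ.δ x r (g r) + g r * mult r xs)
    ≡⟨ ℕΣ.Σ-∙ M (λ r → ℕΣ.δ x r (g r)) (λ r → g r * mult r xs) ⟩
  ℕΣ.Σ< M (λ r → ℕΣ.δ x r (g r)) + ℕΣ.Σ< M (λ r → g r * mult r xs)
    ≡⟨ cong₂ _+_ (ℕΣ.Σ-δ′ M x g x<M) (sym (listSum-mult M g xs xs<M)) ⟩
  g x + ℕΣ.listSum g xs ∎)
  where
  open ≡-Reasoning
  scale : ∀ b c → c * (if b then 1 else 0) ≡ (if b then c else 0)
  scale true  c = ℕ.*-identityʳ c
  scale false c = ℕ.*-zeroʳ c

module _ (E : ℕ) where
  private
    N = E * 2

  absResidue : ℕ → ℕ
  absResidue t = if t ≤ᵇ E then t else suc N ∸ t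

  absResidue-small : ∀ {t} → t ≤ E → absResidue t ≡ t
  absResidue-small {t} t≤E rewrite dec-true (t ≤? E) t≤E = refl

  absResidue-large : ∀ {t} → E < t → absResidue t ≡ suc N ∸ t
  absResidue-large {t} E<t rewrite dec-false (t ≤? E) (ℕ.<⇒≱ E<t) = refl

  ∣lift∣ : ∀ x → ∣ lift N x ∣ ≡ absResidue (toℕ x)
  ∣lift∣ x rewrite half-odd E with toℕ x ≤ᵇ E
  ... | true  = refl
  ... | false = ℤ.∣-i∣≡∣i∣ (+ (suc N ∸ toℕ x))

  N≡E+E : N ≡ E + E
  N≡E+E = trans (ℕ.*-comm E 2) (cong (λ z → E + z) (ℕ.+-identityʳ E))

  absResidue-neg : ∀ t → t < suc N → absResidue ((suc N ∸ t) % suc N) ≡ absResidue t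
  absResidue-neg zero    _ = cong absResidue (n%n≡0 (suc N))
  absResidue-neg (suc t) (s≤s t<N) with suc t ≤? E
  ... | yes t<E rewrite m<n⇒m%n≡m (s≤s (ℕ.m∸n≤m N t)) =
    trans (absResidue-large (complement-bound t<E))
      (trans (trans (ℕ.+-∸-assoc 1 (ℕ.m∸n≤m N t)) (cong suc (ℕ.m∸[m∸n]≡n (ℕ.<⇒≤ t<N)))) (sym (absResidue-small t<E)))
  ... | no t≮E rewrite m<n⇒m%n≡m (s≤s (ℕ.m∸n≤m N t)) =
    trans (absResidue-small (ℕ.m≤n+o⇒m∸n≤o N t (subst (_≤ t + E) (sym N≡E+E) (ℕ.+-monoˡ-≤ E (ℕ.≮⇒≥ t≮E)))))
      (sym (absResidue-large (ℕ.≰⇒> t≮E)))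

  Σ-absResidue : ∀ (h : ℕ → ℕ) → ℕΣ.Σ< N (λ r → h (absResidue (suc r))) ≡ ℕΣ.Σ< E (h ∘ suc) * 2
  Σ-absResidue h = begin
    ℕΣ.Σ< N g                                        ≡⟨ cong (λ t → ℕΣ.Σ< t g) N≡E+E ⟩
    ℕΣ.Σ< (E + E) g                                  ≡⟨ ℕΣ.Σ-++ E E g ⟩
    ℕΣ.Σ< E g + ℕΣ.Σ< E (λ i → g (E + i))
      ≡⟨ cong₂ _+_ (ℕΣ.Σ-cong E λ r r<E → cong h (absResidue-small r<E))
           (trans (ℕΣ.Σ-cong E λ i _ → cong h (trans (absResidue-large (s≤s (ℕ.m≤m+n E i))) (complement i))) (reverse E)) ⟩
    ℕΣ.Σ< E (h ∘ suc) + ℕΣ.Σ< E (h ∘ suc)            ≡⟨ twice (ℕΣ.Σ< E (h ∘ suc)) ⟩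
    ℕΣ.Σ< E (h ∘ suc) * 2                            ∎
    where
    open ≡-Reasoning
    g : ℕ → ℕ
    g r = h (absResidue (suc r))
    twice : ∀ a → a + a ≡ a * 2
    twice = ℕSolver.solve-∀
    complement : ∀ i → N ∸ (E + i) ≡ E ∸ i
    complement i = trans (cong (_∸ (E + i)) N≡E+E) (ℕ.[m+n]∸[m+o]≡n∸o E E i)
    reverse : ∀ E → ℕΣ.Σ< E (λ i → h (E ∸ i)) ≡ ℕΣ.Σ< E (h ∘ suc)
    reverse zero    = refl
    reverse (suc E) = trans (cong (λ z → h (suc E) + z) (reverse E))
      (trans (ℕ.+-comm (h (suc E)) _) (sym (ℕΣ.Σ-last E (h ∘ suc))))

  pmList-bounded : ∀ xs → All (_< suc N) (pmList N xs)
  pmList-bounded []       = []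
  pmList-bounded (x ∷ xs) = toℕ<n x ∷ m%n<n (suc N ∸ toℕ x) (suc N) ∷ pmList-bounded xs

  listSum-pmList : ∀ (h : ℕ → ℕ) xs → ℕΣ.listSum (h ∘ absResidue) (pmList N xs) ≡ ℕΣ.listSum (λ x → h ∣ lift N x ∣) xs * 2
  listSum-pmList h []       = refl
  listSum-pmList h (x ∷ xs) rewrite absResidue-neg (toℕ x) (toℕ<n x) | sym (∣lift∣ x) | listSum-pmList h xs =
    twice (h ∣ lift N x ∣) (ℕΣ.listSum (λ x → h ∣ lift N x ∣) xs)
    where
    twice : ∀ a b → a + (a + b * 2) ≡ (a + b) * 2
    twice = ℕSolver.solve-∀

  module _ {m n s k} (H : Heffter m n s k N) where
    open Heffter H

    -- The list of ± entries counts every cell twice. Multiplicity 2 for all 2E nonzero residues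
    -- counts every absolute value four times, so each occurs in two cells. The condition `h 0 ≡ 0`
    -- removes the residue 0, whose multiplicity is not prescribed.
    abs-total : ∀ (h : ℕ → ℕ) → h 0 ≡ 0 →
                ℕΣ.listSum (λ x → h ∣ lift N x ∣) (allEntries array) ≡ ℕΣ.Σ< E (h ∘ suc) * 2
    abs-total h h0 = ℕ.*-cancelʳ-≡ _ _ 2 (begin
      ℕΣ.listSum (λ x → h ∣ lift N x ∣) (allEntries array) * 2          ≡⟨ listSum-pmList h (allEntries array) ⟨
      ℕΣ.listSum (h ∘ absResidue) L                                     ≡⟨ listSum-mult (suc N) (h ∘ absResidue) L (pmList-bounded (allEntries array)) ⟩
      h 0 * mult 0 L + ℕΣ.Σ< N (λ r → h (absResidue (suc r)) * mult (suc r) L)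
        ≡⟨ cong₂ _+_ (cong (_* mult 0 L) h0) (ℕΣ.Σ-cong N λ r r<N →
             trans (cong (λ z → h (absResidue (suc r)) * z) (multiplicity (suc r) (s≤s z≤n) (s≤s r<N)))
                   (sym (twice (h (absResidue (suc r)))))) ⟩
      ℕΣ.Σ< N (λ r → h (absResidue (suc r)) + h (absResidue (suc r)))   ≡⟨ ℕΣ.Σ-∙ N g g ⟩
      ℕΣ.Σ< N g + ℕΣ.Σ< N g                                             ≡⟨ twice (ℕΣ.Σ< N g) ⟩
      ℕΣ.Σ< N g * 2                                                     ≡⟨ cong (_* 2) (Σ-absResidue h) ⟩
      ℕΣ.Σ< E (h ∘ suc) * 2 * 2                                         ∎)
      where
      open ≡-Reasoning
      L = pmList N (allEntries array)
      g : ℕ → ℕ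
      g r = h (absResidue (suc r))
      twice : ∀ a → a + a ≡ a * 2
      twice = ℕSolver.solve-∀

∣∣-opposite : ∀ a b → a ℤ.+ (b ℤ.+ + 0) ≡ + 0 → ∣ a ∣ ≡ ∣ b ∣
∣∣-opposite a b eq = trans (cong ∣_∣ a≡-b) (ℤ.∣-i∣≡∣i∣ b)
  where
  a≡-b : a ≡ - b
  a≡-b = trans (solve a b) (trans (cong (λ z → z ℤ.+ - b) eq) (ℤ.+-identityˡ (- b)))
    where
    solve : ∀ a b → a ≡ (a ℤ.+ (b ℤ.+ + 0)) ℤ.+ - b
    solve = ℤSolver.solve-∀

-- Two entries with sum zero have equal absolute values, so any weight of absolute values occurs
-- twice in the line.
double-term≤ : ∀ {N} (h : ℕ → ℕ) (xs : List (Fin (suc N))) → length xs ≡ 2 → sumℤ (map (lift N) xs) ≡ + 0 →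
               All (λ x → h ∣ lift N x ∣ * 2 ≤ ℕΣ.listSum (λ x → h ∣ lift N x ∣) xs) xs
double-term≤ {N} h (x ∷ y ∷ []) refl eq = bound (cong h x≡y) ∷ bound′ (cong h x≡y) ∷ []
  where
  x≡y : ∣ lift N x ∣ ≡ ∣ lift N y ∣
  x≡y = ∣∣-opposite (lift N x) (lift N y) eq
  twice : ∀ a → a * 2 ≡ a + (a + 0)
  twice = ℕSolver.solve-∀
  bound : ∀ {a b} → a ≡ b → a * 2 ≤ a + (b + 0)
  bound {a} refl = ℕ.≤-reflexive (twice a)
  bound′ : ∀ {a b} → a ≡ b → b * 2 ≤ a + (b + 0)
  bound′ {a} refl = ℕ.≤-reflexive (twice a)

All-mapMaybe : ∀ {B C : Set} {P : B → Set} (g : C → Maybe B) {n} (f : Fin n → C) →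
               All P (mapMaybe g (tabulate f)) → ∀ j x → g (f j) ≡ just x → P x
All-mapMaybe g {suc n} f all j x eq with g (f Fin.zero) in eq₀
All-mapMaybe g {suc n} f (px ∷ all) Fin.zero    x eq | just y with trans (sym eq₀) eq
... | refl = px
All-mapMaybe g {suc n} f (px ∷ all) (Fin.suc j) x eq | just y = All-mapMaybe g (f ∘ Fin.suc) all j x eq
All-mapMaybe g {suc n} f all        Fin.zero    x eq | nothing with trans (sym eq₀) eq
... | ()
All-mapMaybe g {suc n} f all        (Fin.suc j) x eq | nothing = All-mapMaybe g (f ∘ Fin.suc) all j x eq

-- A cell holding ±1 would force a second one in its row and a third one in its column.
¬heffter-2-2 : ∀ E {m n} → 0 < E → Heffter m n 2 2 (E * 2) → ⊥
¬heffter-2-2 (suc E′) {m} {n} _ H = ℕ.1+n≢0 {1} (begin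
  2                                                 ≡⟨ cong (λ z → suc z * 2) (ℕΣ.Σ-ε E′) ⟨
  ℕΣ.Σ< (suc E′) (h ∘ suc) * 2                      ≡⟨ abs-total (suc E′) H h refl ⟨
  ℕΣ.listSum w (allEntries array)                   ≡⟨ total ⟩
  ℕSum.sum (λ i → ℕSum.sum (c i))                   ≡⟨ sum-const _ (λ i → trans (sum-const (c i) (zero-cell i)) (ℕ.*-zeroʳ n)) ⟩
  m * 0                                             ≡⟨ ℕ.*-zeroʳ m ⟩
  0                                                 ∎)
  where
  open ≡-Reasoning
  open Heffter H
  N = suc E′ * 2
  h : ℕ → ℕ
  h y = ℕΣ.δ y 1 1
  w : Fin (suc N) → ℕ
  w x = h ∣ lift N x ∣
  open ℕΣ.Stats w array using (row-sum; col-sum; all-rows) renaming (cell to c)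
  total : ℕΣ.listSum w (allEntries array) ≡ ℕSum.sum (λ i → ℕSum.sum (c i))
  total = trans all-rows (ℕSum.sum-cong-≗ row-sum)
  total≡2 : ℕSum.sum (λ i → ℕSum.sum (c i)) ≡ 2
  total≡2 = trans (sym total) (trans (abs-total (suc E′) H h refl) (cong (λ z → suc z * 2) (ℕΣ.Σ-ε E′)))
  row≥ : ∀ i j → c i j * 2 ≤ ℕSum.sum (c i)
  row≥ i j with array i j in eq
  ... | nothing = z≤n
  ... | just x  = subst (w x * 2 ≤_) (row-sum i)
    (All-mapMaybe (array i) id (double-term≤ h (rowEntries array i) (row-length i) (proj₁ integer i)) j x eq)
  col≥ : ∀ i j → c i j * 2 ≤ ℕSum.sum (λ i → c i j)
  col≥ i j with array i j in eq
  ... | nothing = z≤n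
  ... | just x  = subst (w x * 2 ≤_) (col-sum j)
    (All-mapMaybe (λ i → array i j) id (double-term≤ h (colEntries array j) (col-length j) (proj₂ integer j)) i x eq)
  zero-cell : ∀ i j → c i j ≡ 0
  zero-cell i j = small (c i j) (ℕ.≤-trans (ℕ.+-mono-≤ (row≥ i j) (col≥ i j))
    (ℕ.≤-trans (row+col≤total c i j) (ℕ.≤-reflexive (cong (λ z → z + c i j) total≡2))))
    where
    small : ∀ a → a * 2 + a * 2 ≤ 2 + a → a ≡ 0
    small zero    _  = refl
    small (suc a) (s≤s (s≤s le)) = ⊥-elim (ℕ.<⇒≱ (ℕ.m<m+n (suc a) (s≤s z≤n)) (ℕ.≤-trans (ℕ.≤-reflexive (rearrange a)) le))
      where
      rearrange : ∀ a → suc a + suc (a + (a + a)) ≡ a * 2 + suc a * 2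
      rearrange = ℕSolver.solve-∀

-- Passing to absolute values preserves parity. The difference is a natural even number, so that for
-- a vanishing sum the equation descends to ℕ.
abs-parity : ∀ z → ∃ λ d → + ∣ z ∣ ≡ z ℤ.+ + (d * 2)
abs-parity (+ a)    = 0 , sym (ℤ.+-identityʳ (+ a))
abs-parity -[1+ a ] = suc a , (trans (solve (+ suc a)) (cong (λ z → -[1+ a ] ℤ.+ z) (sym (ℤ.pos-* (suc a) 2))))
  where
  solve : ∀ z → z ≡ - z ℤ.+ z ℤ.* + 2
  solve = ℤSolver.solve-∀

sum-abs-parity : ∀ {N} (xs : List (Fin (suc N))) →
                 ∃ λ d → + ℕΣ.listSum (λ x → ∣ lift N x ∣) xs ≡ sumℤ (map (lift N) xs) ℤ.+ + (d * 2)
sum-abs-parity     []       = 0 , refl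
sum-abs-parity {N} (x ∷ xs) with abs-parity (lift N x) | sum-abs-parity xs
... | d , p | e , q = d + e , trans (cong₂ ℤ._+_ p q) (trans (solve (lift N x) (+ (d * 2)) (sumℤ (map (lift N) xs)) (+ (e * 2)))
    (cong (λ z → (lift N x ℤ.+ sumℤ (map (lift N) xs)) ℤ.+ + z) (sym (ℕ.*-distribʳ-+ 2 d e))))
  where
  solve : ∀ a b c d → (a ℤ.+ b) ℤ.+ (c ℤ.+ d) ≡ (a ℤ.+ c) ℤ.+ (b ℤ.+ d)
  solve = ℤSolver.solve-∀

two-columns : ∀ K {m k} → Heffter m 2 2 k (K * 2 * 2) → 4 ∣ K * 2
two-columns K {m} H with parity K
... | even i = divides i (ℕ.*-assoc i 2 2)
... | odd i  = ⊥-elim (contradict (sum-abs-parity (colEntries array Fin.zero)))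
  where
  open Heffter H
  open ≡-Reasoning
  E = suc (i * 2) * 2
  N = E * 2
  w : Fin (suc N) → ℕ
  w x = ∣ lift N x ∣
  open ℕΣ.Stats w array using (row-sum; col-sum; all-rows) renaming (cell to c)
  full-row : ∀ i → ℕSum.sum (c i) ≡ c i Fin.zero + c i Fin.zero
  full-row i with array i Fin.zero | array i (Fin.suc Fin.zero) | row-length i | proj₁ integer i
  ... | nothing | nothing | () | _
  ... | nothing | just _  | () | _
  ... | just _  | nothing | () | _
  ... | just x  | just y  | _  | eq = cong (λ z → w x + z) (trans (ℕ.+-identityʳ (w y)) (sym (∣∣-opposite (lift N x) (lift N y) eq)))
  triangle : ∀ E → ℕΣ.Σ< E suc * 2 ≡ E * suc E
  triangle zero    = refl
  triangle (suc E) = trans (cong (_* 2) (ℕΣ.Σ-last E suc))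
    (trans (ℕ.*-distribʳ-+ 2 (ℕΣ.Σ< E suc) (suc E)) (trans (cong (λ z → z + suc E * 2) (triangle E)) (arith E)))
    where
    arith : ∀ E → E * suc E + suc E * 2 ≡ suc E * suc (suc E)
    arith = ℕSolver.solve-∀
  total₀ : ℕ
  total₀ = ℕΣ.listSum w (colEntries array Fin.zero)
  total₀*2 : total₀ * 2 ≡ E * suc E
  total₀*2 = begin
    total₀ * 2                                      ≡⟨ cong (_* 2) (col-sum Fin.zero) ⟩
    ℕSum.sum c₀ * 2                                 ≡⟨ twice (ℕSum.sum c₀) ⟩
    ℕSum.sum c₀ + ℕSum.sum c₀                       ≡⟨ ℕSum.∑-distrib-+ c₀ c₀ ⟨
    ℕSum.sum (λ i → c₀ i + c₀ i)                    ≡⟨ ℕSum.sum-cong-≗ full-row ⟨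
    ℕSum.sum (λ i → ℕSum.sum (c i))                 ≡⟨ ℕSum.sum-cong-≗ row-sum ⟨
    ℕSum.sum (λ i → ℕΣ.listSum w (rowEntries array i))  ≡⟨ all-rows ⟨
    ℕΣ.listSum w (allEntries array)                 ≡⟨ abs-total E H id refl ⟩
    ℕΣ.Σ< E suc * 2                                 ≡⟨ triangle E ⟩
    E * suc E                                       ∎
    where
    c₀ = λ i → c i Fin.zero
    twice : ∀ a → a * 2 ≡ a + a
    twice = ℕSolver.solve-∀
  contradict : (∃ λ d → + total₀ ≡ sumℤ (map (lift N) (colEntries array Fin.zero)) ℤ.+ + (d * 2)) → ⊥
  -- For K = 2i + 1 and E = 2K, E(E + 1)/2 = (2i + 1)(4i + 3) = 2(4i² + 5i + 1) + 1 is odd.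
  contradict (d , eq) = ℕ.even≢odd d (suc (5 * i + 4 * (i * i))) (ℕ.*-cancelʳ-≡ _ _ 2 (begin
    2 * d * 2                              ≡⟨ cong (_* 2) (ℕ.*-comm 2 d) ⟩
    d * 2 * 2                              ≡⟨ cong (_* 2) total₀≡ ⟨
    total₀ * 2                             ≡⟨ total₀*2 ⟩
    E * suc E                              ≡⟨ arith i ⟩
    suc (2 * (suc (5 * i + 4 * (i * i)))) * 2    ∎))
    where
    total₀≡ : total₀ ≡ d * 2
    total₀≡ = ℤ.+-injective (trans eq (trans (cong (λ z → z ℤ.+ + (d * 2)) (proj₂ integer Fin.zero)) (ℤ.+-identityˡ _)))
    arith : ∀ i → suc (i * 2) * 2 * suc (suc (i * 2) * 2) ≡ suc (2 * (suc (5 * i + 4 * (i * i)))) * 2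
    arith = ℕSolver.solve-∀

filled-cells : ∀ {m n s k N} → Heffter m n s k N → m * s ≡ n * k
filled-cells {m} {n} H = begin
  m * _                                                             ≡⟨ sum-const _ (λ i → trans (sym (length-Σ (rowEntries array i))) (row-length i)) ⟨
  ℕSum.sum (λ i → ℕΣ.listSum (λ _ → 1) (rowEntries array i))        ≡⟨ ℕΣ.Stats.all-rows (λ _ → 1) array ⟨
  ℕΣ.listSum (λ _ → 1) (allEntries array)                           ≡⟨ ℕΣ.Stats.all-cols (λ _ → 1) array ⟩
  ℕSum.sum (λ j → ℕΣ.listSum (λ _ → 1) (colEntries array j))        ≡⟨ sum-const _ (λ j → trans (sym (length-Σ (colEntries array j))) (col-length j)) ⟩
  n * _                                                             ∎
  where
  open ≡-Reasoning
  open Heffter H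

row-fits : ∀ {m n s k N} → 0 < m → Heffter m n s k N → s ≤ n
row-fits {suc m} {n} _ H = subst (_≤ n) (row-length Fin.zero)
  (ℕ.≤-trans (length-mapMaybe (array Fin.zero) (allFin n)) (ℕ.≤-reflexive (length-tabulate id)))
  where open Heffter H

-- For n = 2, counting filled cells gives m = k. Otherwise `row-fits` gives 3 ≤ n, and since k is
-- even and positive, 3 ≤ k only requires k ≠ 2, which is `¬heffter-2-2`. Applied to the transpose,
-- the same lemma yields the condition on k = 2.
row-pairs : ∀ {m n K} → 0 < m → 0 < n → 0 < K → Heffter m n 2 (K * 2) (n * (K * 2)) →
            (n ≡ 2 × m ≡ K * 2 × 4 ∣ K * 2) ⊎ (3 ≤ n × 3 ≤ K * 2)
row-pairs {m} {n} {K} 0<m 0<n 0<K H with n ℕ.≟ 2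
... | yes refl = inj₁ (refl , ℕ.*-cancelʳ-≡ m (K * 2) 2 (trans (filled-cells H) (ℕ.*-comm 2 (K * 2))) ,
    two-columns K (subst (Heffter m 2 2 (K * 2)) (ℕ.*-comm 2 (K * 2)) H))
... | no n≢2 = inj₂ (ℕ.≤∧≢⇒< (row-fits 0<m H) (n≢2 ∘ sym) , 3≤K*2 K 0<K H)
  where
  3≤K*2 : ∀ K → 0 < K → Heffter m n 2 (K * 2) (n * (K * 2)) → 3 ≤ K * 2
  3≤K*2 1             _ H = ⊥-elim (¬heffter-2-2 n 0<n H)
  3≤K*2 (suc (suc K)) _ H = s≤s (s≤s (s≤s z≤n))

positive-half : ∀ K → 0 < K * 2 → 0 < K
positive-half (suc K) _ = z<s

theorem4p9 : (m n s k : ℕ) → 0 < m → 0 < n → 0 < s → 0 < k → 2 ∣ s → 2 ∣ k →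
    (Σ (PFArray m n (Data.Nat.suc (n * k))) (λ A → IsH2 m n s k A × IsInteger m n (n * k) A))
    ⇔ (m * s ≡ n * k × 2 ≤ s × s ≤ n × 2 ≤ k × k ≤ m ×
    (s ≡ 2 → (n ≡ 2 × m ≡ k × 4 ∣ k) ⊎ (3 ≤ n × 3 ≤ k)) ×
    (k ≡ 2 → (m ≡ 2 × n ≡ s × 4 ∣ s) ⊎ (3 ≤ m × 3 ≤ s)))
theorem4p9 m n _ _ 0<m 0<n 0<s 0<k (divides S refl) (divides K refl) = mk⇔ necessary sufficient
  where
  0<S = positive-half S 0<s
  0<K = positive-half K 0<k
  necessary : _
  necessary A = filled-cells H , ℕ.*-monoˡ-≤ 2 0<S , row-fits 0<m H , ℕ.*-monoˡ-≤ 2 0<K , row-fits 0<n (transpose H) ,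
    (λ s≡2 → row-pairs 0<m 0<n 0<K (subst (λ s → Heffter m n s (K * 2) (n * (K * 2))) s≡2 H)) ,
    (λ k≡2 → row-pairs 0<n 0<m 0<S (subst (λ k → Heffter n m k (S * 2) (m * (S * 2))) k≡2
      -- Transposition keeps the modulus given by n * k, while `row-pairs` for the transpose expects
      -- m * s.
      (subst (Heffter n m (K * 2) (S * 2)) (sym (filled-cells H)) (transpose H))))
    where
    H : Heffter m n (S * 2) (K * 2) (n * (K * 2))
    H = H2⇒heffter A
  sufficient : _
  sufficient (ms≡nk , _ , s≤n , _ , k≤m , s=2 , k=2) = heffter⇒H2 (exists m n S K 0<m 0<n
    (ℕ.*-cancelʳ-≡ (m * S) (n * K) 2 (trans (ℕ.*-assoc m S 2) (trans ms≡nk (sym (ℕ.*-assoc n K 2)))))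
    s≤n k≤m 0<S 0<K
    (λ S≡1 → drop-middle (s=2 (cong (_* 2) S≡1)))
    (λ K≡1 → drop-middle (k=2 (cong (_* 2) K≡1))))
    where
    drop-middle : ∀ {A B C D : Set} → (A × B × C) ⊎ D → (A × C) ⊎ D
    drop-middle (inj₁ (a , _ , c)) = inj₁ (a , c)
    drop-middle (inj₂ d)           = inj₂ d
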